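{- Let $t=2m'+1\ge3$ be odd, $r\ge2$, and fix $\Lambda$ and $X$; put the matrix $M(\Lambda,X)$ in the interval form described in the context. Let $B$ be one of its blocks, with rows indexed $1,\dots,n$, and let $$\partial:\mathbb Z^n\to\mathbb Z^{n+1},\qquad\partial(x_1,\dots,x_n)=(x_1,\ x_2-x_1,\ \dots,\ x_n-x_{n-1},\ -x_n).$$ Then $\partial$ is injective and identifies $\mathbb Z^n$ with the root lattice $A_n=\{y\in\mathbb Z^{n+1}:\sum_iy_i=0\}$, with inverse $x_k=y_1+\dots+y_k$; and $\partial\,\mathbf 1_{[a,b]}=e_a-e_{b+1}$ for the indicator of an interval. Write $\alpha:=1$, $\omega:=n+1$ and $v_2,\dots,v_n$ for the remaining coordinates. Every nonzero column of $B$ is a proper prefix $[1,k]$, a proper suffix $[k+1,n]$ or the full interval $[1,n]$, and $\partial$ sends these to the edges $\alpha v_{k+1}$, $v_{k+1}\omega$ and $\alpha\omega$ respectively, while a zero column becomes a loop. So the columns of $B$ are the oriented edges of a multigraph $G_B$ on $\{\alpha,v_2,\dots,v_n,\omega\}$ whose non-loop part satisfies $$G_B\setminus\{\text{loops}\}\subseteq K_{2,n-1}+\alpha\omega,$$ with parallel edges allowed; the loops are exactly the zero columns. The column matroid of $B$ is the cycle matroid of $G_B$; in particular $B$ has linearly independent columns if and only if $G_B$ is a forest.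
   Context: Let $R'=m'+r$, $\Lambda=(\Lambda_1\ge\dots\ge\Lambda_{R'}\ge0)$ integers, $X\in\mathbb Z^r$, $V_i=2\Lambda_i+2(R'-i)+1$. The folded class of an integer $a$ is the unique $c\in\{0,\dots,m'\}$ with $a\equiv\pm c\pmod t$; its folding sign is $+1$ if $a\equiv c\pmod t$ and $-1$ otherwise. $M(\Lambda,X)$ is the $R'\times R'$ matrix with rows $i=1,\dots,R'$ and $m'$ frozen columns followed by $r$ free columns. The $p$-th frozen column ($1\le p\le m'$) has in row $i$ the folding sign of $V_i$ if $V_i$ has folded class $m'-p+1$, else $0$. The $j$-th free column ($1\le j\le r$) has in row $i$ the sum of those $\varepsilon\in\{\pm1\}$ with $\varepsilon V_i=X_j+tk$ for some odd integer $k\ge1$ ($0$ if none). Interval form: let $c_i,\sigma_i$ be the folded class and folding sign of $V_i$, $w_i=\sigma_iV_i$; for a free column $j$ let $b_j,\tau_j$ be the folded class and folding sign of $X_j$ (so $\tau_j=+1$ if $b_j=0$), and $\tau_j=+1$ for frozen columns. Multiply the entry in row $i$, column $j$ by $\sigma_i\tau_j$ and order rows by $(c_i,w_i)$ increasing lexicographically. The result is a $0/1$ matrix with consecutive ones in each column, block diagonal with one block per class $c\in\{0,\dots,m'\}$: the rows with $c_i=c$ and the columns consisting of the frozen column asking for class $c$ (if $c\ge1$) and the free columns with $b_j=c$. Blocks need not be square. $K_{2,n-1}+\alpha\omega$ is the complete bipartite graph with parts $\{\alpha,\omega\}$ and $\{v_2,\dots,v_n\}$ together with the edge $\alpha\omega$.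 Loops and pairs of parallel edges count as cycles. -}

module Defs where

open import Data.Bool.Base using (if_then_else_)
open import Data.Fin.Base using (Fin; zero; suc; toℕ; fromℕ; inject₁; splitAt)
open import Data.Fin.Subset using (Subset; _∈_; _∉_)
open import Data.Integer.Base using (ℤ; +_; -_; _+_; _-_; _*_; _≤_; 0ℤ; 1ℤ; -1ℤ; ∣_∣)
open import Data.Integer.DivMod using (_%ℕ_; _/ℕ_; n%ℕd<d; a≡a%ℕn+[a/ℕn]*n)
open import Data.Integer.Divisibility.Signed using (_∣_; divides; _∣?_; ∣⇒∣ᵤ; ∣m∣n⇒∣m-n)
open import Data.List.Base using (List; allFin; filter; length; lookup)
open import Data.Nat.Base as ℕ using (ℕ; zero; suc; _∸_)
open import Data.Product.Base using (_×_; _,_; ∃)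
open import Data.Product.Relation.Binary.Lex.NonStrict using (×-decTotalOrder)
open import Data.Rational.Base as ℚ using (ℚ; 0ℚ)
open import Data.Sum.Base using (_⊎_; inj₁; inj₂; [_,_]′)
open import Data.Vec.Functional using (Vector; _∷_; tail; insertAt)
open import Function.Definitions using (Injective)
open import Relation.Binary.Bundles using (DecTotalOrder)
open import Relation.Binary.PropositionalEquality
open import Relation.Nullary using (¬_; Dec; yes; no; does; contradiction; _×-dec_; ¬?; map′; ofʸ; ofⁿ)
import Algebra.Properties.CommutativeMonoid.Sum as Sum
import Data.Integer.Properties as ℤₚ
import Data.Integer.Tactic.RingSolver as ℤ-Solver
import Data.List.Sort as Sort
import Data.Nat.Divisibility as ℕ∣
import Data.Nat.Properties as ℕₚ
import Data.Rational.Properties as ℚₚ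
import Relation.Binary.Construct.On as On

open Sum ℤₚ.+-0-commutativeMonoid public using () renaming (sum to sumℤ)
open Sum ℚₚ.+-0-commutativeMonoid public using () renaming (sum to sumℚ)

Matrix : ℕ → ℕ → Set
Matrix m k = Fin m → Fin k → ℤ

column : ∀ {m k} → Matrix m k → Fin k → Vector ℤ m
column A j i = A i j

-- Mathematical indices start at 1: `pos i` is the index that i : Fin n stands for.
pos : ∀ {n} → Fin n → ℕ
pos i = suc (toℕ i)

infix 4 _≡_[mod_]
_≡_[mod_] : ℤ → ℤ → ℕ → Set
a ≡ b [mod t ] = + t ∣ a - b

modulus : ℕ → ℕ
modulus m' = suc (2 ℕ.* m')

foldedClass : ℕ → ℤ → ℕ
foldedClass m' a = if does (s ℕₚ.≤? m') then s else modulus m' ∸ s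
  where s = a %ℕ modulus m'

foldingSign : ℕ → ℤ → ℤ
foldingSign m' a =
  if does (+ modulus m' ∣? (a - + foldedClass m' a)) then 1ℤ else -1ℤ

-- These lemmas justify the formula for `foldedClass`: it is the unique
-- c ∈ {0,…,m'} with a ≡ ± c (mod t).

IsFoldedClass : ℕ → ℤ → ℕ → Set
IsFoldedClass m' a c =
  c ℕ.≤ m' × (a ≡ + c [mod modulus m' ] ⊎ a ≡ - (+ c) [mod modulus m' ])

foldedClass-correct : ∀ m' a → IsFoldedClass m' a (foldedClass m' a)
foldedClass-correct m' a with a %ℕ modulus m' in eq
... | s with s ℕ.≤ᵇ m' | ℕₚ.≤ᵇ-reflects-≤ s m'
...   | _ | ofʸ s≤m' = s≤m' , inj₁ (divides (a /ℕ t) (begin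
        a - + s                            ≡⟨ cong (_- + s) division ⟩
        (+ s + (a /ℕ t) * + t) - + s       ≡⟨ rearrange (+ s) ((a /ℕ t) * + t) ⟩
        (a /ℕ t) * + t                     ∎))
  where
  open ≡-Reasoning
  t = modulus m'
  division : a ≡ + s + (a /ℕ t) * + t
  division = trans (a≡a%ℕn+[a/ℕn]*n a t) (cong (λ u → + u + (a /ℕ t) * + t) eq)
  rearrange : ∀ x y → (x + y) - x ≡ y
  rearrange = ℤ-Solver.solve-∀
...   | _ | ofⁿ s≰m' = bound , inj₂ (divides (a /ℕ t + 1ℤ) (begin
        a - - (+ (t ∸ s))
          ≡⟨ cong₂ (λ u v → u - - v) division complement ⟩
        (+ s + (a /ℕ t) * + t) - - (+ t - + s)
          ≡⟨ rearrange (+ s) (a /ℕ t) (+ t) ⟩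
        (a /ℕ t + 1ℤ) * + t ∎))
  where
  open ≡-Reasoning
  t = modulus m'
  s≤t : s ℕ.≤ t
  s≤t = ℕₚ.<⇒≤ (subst (ℕ._< t) eq (n%ℕd<d a t))
  complement : + (t ∸ s) ≡ + t - + s
  complement = trans (sym (ℤₚ.⊖-≥ s≤t)) (sym (ℤₚ.m-n≡m⊖n t s))
  division : a ≡ + s + (a /ℕ t) * + t
  division = trans (a≡a%ℕn+[a/ℕn]*n a t) (cong (λ u → + u + (a /ℕ t) * + t) eq)
  rearrange : ∀ x q y → (x + q * y) - - (y - x) ≡ (q + 1ℤ) * y
  rearrange = ℤ-Solver.solve-∀
  bound : t ∸ s ℕ.≤ m'
  bound = ℕₚ.≤-trans (ℕₚ.∸-monoʳ-≤ t (ℕₚ.≰⇒> s≰m'))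
            (ℕₚ.≤-reflexive (trans (ℕₚ.m+n∸m≡n m' (m' ℕ.+ 0)) (ℕₚ.+-identityʳ m')))

foldedClass-unique : ∀ m' a {c c'} →
  IsFoldedClass m' a c → IsFoldedClass m' a c' → c ≡ c'
foldedClass-unique m' a {c} {c'} (c≤ , p) (c'≤ , p') = go p p'
  where
  t = modulus m'

  c+c'<t : c ℕ.+ c' ℕ.< t
  c+c'<t = ℕ.s≤s (ℕₚ.+-mono-≤ c≤ (ℕₚ.≤-trans c'≤ (ℕₚ.≤-reflexive (sym (ℕₚ.+-identityʳ m')))))

  vanish : ∀ z → + t ∣ z → ∣ z ∣ ℕ.≤ c ℕ.+ c' → z ≡ 0ℤ
  vanish z t∣z z≤ with ∣ z ∣ in eq | ∣⇒∣ᵤ t∣z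
  ... | zero  | _   = ℤₚ.∣i∣≡0⇒i≡0 eq
  ... | suc k | t∣k = contradiction
        (ℕₚ.<-≤-trans c+c'<t (ℕₚ.≤-trans (ℕ∣.∣⇒≤ t∣k) z≤)) (ℕₚ.<-irrefl refl)

  from-difference : + t ∣ + c - + c' → c ≡ c'
  from-difference t∣ = ℤₚ.+-injective (ℤₚ.i-j≡0⇒i≡j (+ c) (+ c')
    (vanish _ t∣ (ℤₚ.∣i-j∣≤∣i∣+∣j∣ (+ c) (+ c'))))

  from-sum : + t ∣ + c + + c' → c ≡ c'
  from-sum t∣ = trans (ℕₚ.m+n≡0⇒m≡0 c c+c'≡0) (sym (ℕₚ.m+n≡0⇒n≡0 c c+c'≡0))
    where
    c+c'≡0 : c ℕ.+ c' ≡ 0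
    c+c'≡0 = ℤₚ.+-injective (vanish _ t∣ ℕₚ.≤-refl)

  e₁ : ∀ a x y → (a - y) - (a - x) ≡ x - y
  e₁ = ℤ-Solver.solve-∀
  e₂ : ∀ a x y → (a - - y) - (a - x) ≡ x + y
  e₂ = ℤ-Solver.solve-∀
  e₃ : ∀ a x y → (a - - x) - (a - y) ≡ x + y
  e₃ = ℤ-Solver.solve-∀
  e₄ : ∀ a x y → (a - - x) - (a - - y) ≡ x - y
  e₄ = ℤ-Solver.solve-∀

  go : (a ≡ + c [mod t ] ⊎ a ≡ - (+ c) [mod t ]) →
       (a ≡ + c' [mod t ] ⊎ a ≡ - (+ c') [mod t ]) → c ≡ c'
  go (inj₁ u) (inj₁ v) = from-difference (subst (+ t ∣_) (e₁ a (+ c) (+ c')) (∣m∣n⇒∣m-n v u))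
  go (inj₁ u) (inj₂ v) = from-sum        (subst (+ t ∣_) (e₂ a (+ c) (+ c')) (∣m∣n⇒∣m-n v u))
  go (inj₂ u) (inj₁ v) = from-sum        (subst (+ t ∣_) (e₃ a (+ c) (+ c')) (∣m∣n⇒∣m-n u v))
  go (inj₂ u) (inj₂ v) = from-difference (subst (+ t ∣_) (e₄ a (+ c) (+ c')) (∣m∣n⇒∣m-n u v))

Odd : ℤ → Set
Odd k = ¬ (+ 2 ∣ k)

FreeHit : (t : ℕ) (ε v x : ℤ) → Set
FreeHit t ε v x = ∃ λ k → Odd k × 1ℤ ≤ k × ε * v ≡ x + + t * k

freeHit? : ∀ t .{{_ : ℕ.NonZero t}} ε v x → Dec (FreeHit t ε v x)
freeHit? t ε v x with + t ∣? (ε * v - x)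
... | no t∤ = no λ (k , _ , _ , eq) → t∤ (divides k
        (trans (cong (_- x) eq) (rearrange x (+ t) k)))
  where
  rearrange : ∀ x t k → (x + t * k) - x ≡ k * t
  rearrange = ℤ-Solver.solve-∀
... | yes (divides q εv-x≡qt) =
        map′ (λ (odd , 1≤q) → q , odd , 1≤q , solution)
             (λ (k , odd , 1≤k , eq) → let k≡q = unique k eq in
                subst Odd k≡q odd , subst (1ℤ ≤_) k≡q 1≤k)
             (¬? (+ 2 ∣? q) ×-dec (1ℤ ℤₚ.≤? q))
  where
  expand : ∀ y x → y ≡ x + (y - x)
  expand = ℤ-Solver.solve-∀
  rearrange : ∀ x t k → (x + t * k) - x ≡ k * t
  rearrange = ℤ-Solver.solve-∀
  solution : ε * v ≡ x + + t * q
  solution = trans (expand (ε * v) x)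
    (cong (λ y → x + y) (trans εv-x≡qt (ℤₚ.*-comm q (+ t))))
  unique : ∀ k → ε * v ≡ x + + t * k → k ≡ q
  unique k eq = ℤₚ.*-cancelʳ-≡ k q (+ t)
    (trans (sym (trans (cong (_- x) eq) (rearrange x (+ t) k))) εv-x≡qt)

module _ (m' r : ℕ) (Λ : Fin (m' ℕ.+ r) → ℕ) (X : Fin r → ℤ) where

  private
    R' = m' ℕ.+ r
    t  = modulus m'

  V : Fin R' → ℤ
  V i = + 2 * + Λ i + + 2 * (+ R' - + pos i) + 1ℤ

  askedClass : Fin m' → ℕ
  askedClass p = suc m' ∸ pos p

  frozenEntry : Fin R' → Fin m' → ℤ
  frozenEntry i p =
    if does (foldedClass m' (V i) ℕₚ.≟ askedClass p) then foldingSign m' (V i) else 0ℤ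

  freeEntry : Fin R' → Fin r → ℤ
  freeEntry i j = contribution 1ℤ + contribution -1ℤ
    where
    contribution : ℤ → ℤ
    contribution ε = if does (freeHit? t ε (V i) (X j)) then ε else 0ℤ

  M : Matrix R' R'
  M i j = [ frozenEntry i , freeEntry i ]′ (splitAt m' j)

  rowClass : Fin R' → ℕ
  rowClass i = foldedClass m' (V i)

  rowSign : Fin R' → ℤ
  rowSign i = foldingSign m' (V i)

  w : Fin R' → ℤ
  w i = rowSign i * V i

  columnClass : Fin R' → ℕ
  columnClass j = [ askedClass , (λ j' → foldedClass m' (X j')) ]′ (splitAt m' j)

  columnSign : Fin R' → ℤ
  columnSign j = [ (λ _ → 1ℤ) , (λ j' → foldingSign m' (X j')) ]′ (splitAt m' j)

  rowOrder : DecTotalOrder _ _ _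
  rowOrder = On.decTotalOrder (×-decTotalOrder ℕₚ.≤-decTotalOrder ℤₚ.≤-decTotalOrder)
                              (λ i → rowClass i , w i)

  sortedRows : List (Fin R')
  sortedRows = Sort.sort rowOrder (allFin R')

  blockRows blockColumns : ℕ → List (Fin R')
  blockRows    c = filter (λ i → rowClass i    ℕₚ.≟ c) sortedRows
  blockColumns c = filter (λ j → columnClass j ℕₚ.≟ c) (allFin R')

  height width : ℕ → ℕ
  height c = length (blockRows c)
  width  c = length (blockColumns c)

  -- Rows and columns of the block are listed by their indices in M; within a class,
  -- sortedRows is increasing in w.  Only columns of class c occur, and for c ≥ 1
  -- exactly one of them is frozen.
  block : (c : ℕ) → Matrix (height c) (width c)
  block c k l = rowSign i * columnSign j * M i j
    where
    i = lookup (blockRows c) k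
    j = lookup (blockColumns c) l

infixl 6 _⊕_ _⊝_
_⊕_ _⊝_ : ∀ {n} → Vector ℤ n → Vector ℤ n → Vector ℤ n
(x ⊕ y) i = x i + y i
(x ⊝ y) i = x i - y i

-- Coordinate k of ∂ x is x_k - x_{k-1}, with x_0 = x_{n+1} = 0.
∂ : ∀ {n} → Vector ℤ n → Vector ℤ (suc n)
∂ {n} x = insertAt x (fromℕ n) 0ℤ ⊝ (0ℤ ∷ x)

RootLattice : ∀ n → Vector ℤ (suc n) → Set
RootLattice n y = sumℤ y ≡ 0ℤ

-- y ↦ (y₁ , y₁ + y₂ , … , y₁ + … + yₙ)
partialSums : ∀ {n} → Vector ℤ (suc n) → Vector ℤ n
partialSums {suc n} y zero    = y zero
partialSums {suc n} y (suc k) = y zero + partialSums (tail y) k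

-- The indicator of {a,…,b}, and the a-th unit vector; a and b are 1-based.
𝟙[_,_] : ∀ {n} → ℕ → ℕ → Vector ℤ n
𝟙[ a , b ] i = if does ((a ℕₚ.≤? pos i) ×-dec (pos i ℕₚ.≤? b)) then 1ℤ else 0ℤ

e : ∀ {n} → ℕ → Vector ℤ n
e a i = if does (a ℕₚ.≟ pos i) then 1ℤ else 0ℤ

IsZero : ∀ {n} → Vector ℤ n → Set
IsZero x = ∀ i → x i ≡ 0ℤ

IsProperPrefix IsProperSuffix IsFull : ∀ {n} → Vector ℤ n → Set
IsProperPrefix {n} x = ∃ λ k → 1 ℕ.≤ k × k ℕ.< n × x ≗ 𝟙[ 1 , k ]
IsProperSuffix {n} x = ∃ λ k → 1 ℕ.≤ k × k ℕ.< n × x ≗ 𝟙[ suc k , n ]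
IsFull         {n} x = x ≗ 𝟙[ 1 , n ]

-- Vertices Fin N, oriented edges Fin q; loops and parallel edges are allowed.
record Multigraph (N q : ℕ) : Set where
  field
    src : Fin q → Fin N
    tgt : Fin q → Fin N

  IsLoop : Fin q → Set
  IsLoop j = src j ≡ tgt j

  -- Edge j runs from the a-th to the b-th vertex.
  _runs_⟶_ : Fin q → ℕ → ℕ → Set
  j runs a ⟶ b = pos (src j) ≡ a × pos (tgt j) ≡ b

  Joins : Fin q → Fin N → Fin N → Set
  Joins j u v = (src j ≡ u × tgt j ≡ v) ⊎ (src j ≡ v × tgt j ≡ u)

  -- A cycle of length ℓ + 1 ≥ 1 through distinct vertices along distinct edges;
  -- length 1 is a loop and length 2 a pair of parallel edges.
  record Cycle : Set where
    field
      ℓ                : ℕ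
      vertex           : Fin (suc ℓ) → Fin N
      edge             : Fin (suc ℓ) → Fin q
      vertex-injective : Injective _≡_ _≡_ vertex
      edge-injective   : Injective _≡_ _≡_ edge
      step             : ∀ (i : Fin ℓ) → Joins (edge (inject₁ i)) (vertex (inject₁ i)) (vertex (suc i))
      close            : Joins (edge (fromℕ ℓ)) (vertex (fromℕ ℓ)) (vertex zero)

open Multigraph using (Cycle)

Forest : ∀ {N q} → Multigraph N q → Set
Forest G = ¬ Cycle G

-- The columns of B, after applying ∂, are the oriented edges of G: the edge
-- u → v is read as e_u - e_v.  This fixes every edge except the vertex at which
-- a loop (∂ column = 0) is attached.
_hasEdges∂_ : ∀ {n q} → Multigraph (suc n) q → Matrix n q → Set
G hasEdges∂ B = ∀ j → ∂ (column B j) ≗ e (pos (src j)) ⊝ e (pos (tgt j))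
  where open Multigraph G

α : ℕ
α = 1

ω : ℕ → ℕ
ω n = suc n

-- Adjacency in K_{2,n-1} + αω: the hubs are α and ω, the middle vertices v₂,…,vₙ.
AdjacentInK : ∀ n → Fin (suc n) → Fin (suc n) → Set
AdjacentInK n u v = (Hub u × Middle v) ⊎ (Middle u × Hub v) ⊎ Edgeαω u v ⊎ Edgeαω v u
  where
  Hub Middle : Fin (suc n) → Set
  Hub    x = pos x ≡ α ⊎ pos x ≡ ω n
  Middle x = 2 ℕ.≤ pos x × pos x ℕ.≤ n
  Edgeαω : Fin (suc n) → Fin (suc n) → Set
  Edgeαω x y = pos x ≡ α × pos y ≡ ω n

-- A matroid on the ground set Fin q is represented by its family of independent sets.
IndependentSets : ℕ → Set₁
IndependentSets q = Subset q → Set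

IsRelation : ∀ {n q} → Matrix n q → Vector ℚ q → Set
IsRelation B a = ∀ i → sumℚ (λ j → a j ℚ.* (B i j ℚ./ 1)) ≡ 0ℚ

LinearlyIndependentColumns : ∀ {n q} → Matrix n q → Set
LinearlyIndependentColumns B = ∀ a → IsRelation B a → ∀ j → a j ≡ 0ℚ

columnMatroid : ∀ {n q} → Matrix n q → IndependentSets q
columnMatroid B S =
  ∀ a → (∀ j → j ∉ S → a j ≡ 0ℚ) → IsRelation B a → ∀ j → a j ≡ 0ℚ

cycleMatroid : ∀ {N q} → Multigraph N q → IndependentSets q
cycleMatroid G S = ¬ ∃ λ (C : Cycle G) → ∀ i → Cycle.edge C i ∈ S

{-# OPTIONS --safe #-}
-- After ∂ the columns of B are those of an oriented incidence matrix.  A column of B is the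
-- difference of two partial sums of unit vectors, so signs along a cycle give a relation between
-- its edges.  Conversely a relation is balanced at every vertex; if its support has no loops, no
-- vertex meets exactly one edge of it, and a path in the support can be prolonged until it closes up.
--
-- The columns of B are intervals because, for X even, ε V_i = X + t k has an odd solution k ≥ 1
-- exactly when t ∣ ε V_i - X and X < ε V_i: along the rows, sorted by w_i, this condition is
-- monotone.  For X odd the column vanishes.
module Submission where

open import Defs
open import Algebra.Bundles using (AbelianGroup)
open import Data.Bool.Base using (if_then_else_)
open import Data.Fin.Base using (Fin; zero; suc; toℕ; fromℕ; inject₁; fromℕ<; punchIn; splitAt)
open import Data.Fin.Relation.Unary.Top using (View; view; ‵fromℕ; ‵inject₁)
open import Data.Fin.Subset using (Subset; _∈_; ⊤)
open import Data.Integer.Base as ℤ using (ℤ; 0ℤ; 1ℤ; -1ℤ)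
open import Data.Integer.DivMod using (_%ℕ_; _/ℕ_; n%ℕd<d; a≡a%ℕn+[a/ℕn]*n)
open import Data.Integer.Divisibility.Signed
  using (_∣_; divides; _∣?_; ∣⇒∣ᵤ; ∣m∣n⇒∣m+n; ∣m∣n⇒∣m-n; ∣m⇒∣-m; ∣m+n∣m⇒∣n; ∣n⇒∣m*n; ∣m⇒∣m*n)
open import Data.List.Base using (allFin; filter; lookup)
open import Data.List.Membership.Propositional.Properties using (∈-lookup)
open import Data.List.Relation.Unary.All.Properties using (all-filter)
open import Data.List.Relation.Unary.Sorted.TotalOrder.Properties using (lookup-mono-≤; filter⁺)
open import Data.Nat.Base as ℕ using (ℕ; zero; suc)
open import Data.Product.Base using (_×_; _,_; ∃; ∃₂; proj₁; proj₂)
open import Data.Rational.Base as ℚ using (ℚ; 0ℚ; 1ℚ)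
open import Data.Sum.Base using (_⊎_; inj₁; inj₂; [_,_]′)
open import Data.Vec.Functional using (Vector; _∷_; head; tail; insertAt)
open import Function.Base using (_∘_)
open import Function.Bundles using (_⇔_; mk⇔; Equivalence)
open import Function.Definitions using (Injective)
open import Relation.Binary.Bundles using (DecTotalOrder)
open import Relation.Binary.PropositionalEquality
open import Relation.Nullary using (¬_; Dec; does; yes; no; contradiction; _×-dec_; _⊎-dec_; ¬?)
open import Relation.Nullary.Decidable using (dec-true; dec-false; decidable-stable)
open import Relation.Unary using (Decidable)
import Algebra.Properties.CommutativeMonoid.Sum as Sum
import Algebra.Properties.Group as Group
import Data.Fin.Properties as Finₚ
import Data.Fin.Subset.Properties as Subsetₚ
import Data.Integer.Properties as ℤₚ
import Data.Integer.Tactic.RingSolver as ℤ-Solver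
import Data.List.Relation.Unary.All as All
import Data.List.Sort as Sort
import Data.Nat.Divisibility as ℕ∣
import Data.Nat.Properties as ℕₚ
import Data.Rational.Properties as ℚₚ
import Data.Rational.Solver as ℚ-Solver
import Data.Rational.Unnormalised.Base as ℚᵘ
import Data.Rational.Unnormalised.Properties as ℚᵘₚ
import Data.Vec.Functional.Properties as Vectorₚ

-- Both `V i` and t are odd. Hence, if q t = ε V_i - X, then q is odd exactly when X is even, and q
-- ≥ 1 exactly when X < ε V_i. The obstacle is that an entry sums over both ε. In a class c ≥ 1 only
-- ε = σ τ can satisfy the congruence; then ε V_i = τ w_i, and τ decides between a suffix and a
-- prefix. In class 0 the congruence holds for both signs and the entry is a difference of two
-- indicators, which V_i > 0 turns into a single one. On the graph side, `∂` forgets where a loop is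
-- attached, so `B` does not determine its graph; the properties of the graph are therefore derived
-- from `_hasEdges∂_` alone. Each row of `B` is the gradient of a potential on the vertices, which
-- makes sums along cycles vanish; differences of consecutive rows are the balances at the vertices.

-- Differences and partial sums: `∂` as an isomorphism onto the root lattice

module Boundary where
  open import Data.Integer.Base using (-_; _+_; _-_)
  open Sum ℤₚ.+-0-commutativeMonoid using (sum-cong-≗)
  open Group (AbelianGroup.group ℤₚ.+-0-abelianGroup) using () renaming (∙-cancelˡ to +-cancelˡ)

  -- A recursive form of `∂`: the entry `a` preceding `x` is a parameter, so that the tail can be
  -- treated with `head x` as its predecessor. `∂` is the case `a` = 0.
  increments : ∀ {n} → ℤ → Vector ℤ n → Vector ℤ (suc n)
  increments {zero}  a x i       = 0ℤ - a
  increments {suc n} a x zero    = head x - a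
  increments {suc n} a x (suc i) = increments (head x) (tail x) i

  head∷tail : ∀ {n} (x : Vector ℤ (suc n)) → x ≗ (head x ∷ tail x)
  head∷tail x zero    = refl
  head∷tail x (suc i) = refl

  ⊝≗increments : ∀ {n} a (x : Vector ℤ n) →
    insertAt x (fromℕ n) 0ℤ ⊝ (a ∷ x) ≗ increments a x
  ⊝≗increments {zero}  a x zero    = refl
  ⊝≗increments {suc n} a x zero    = refl
  ⊝≗increments {suc n} a x (suc i) =
    trans (cong (λ u → insertAt (tail x) (fromℕ n) 0ℤ i - u) (head∷tail x i))
          (⊝≗increments (head x) (tail x) i)

  partialSums-cong : ∀ {n} {x y : Vector ℤ (suc n)} → x ≗ y → partialSums x ≗ partialSums y
  partialSums-cong {suc n} x≗y zero    = x≗y zero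
  partialSums-cong {suc n} x≗y (suc k) =
    cong₂ _+_ (x≗y zero) (partialSums-cong (λ i → x≗y (suc i)) k)

  interchange : ∀ a b c d → (a - b) + (c - d) ≡ (a + c) - (b + d)
  interchange = ℤ-Solver.solve-∀

  partialSums-⊝ : ∀ {n} (x y : Vector ℤ (suc n)) →
    partialSums (x ⊝ y) ≗ partialSums x ⊝ partialSums y
  partialSums-⊝ {suc n} x y zero    = refl
  partialSums-⊝ {suc n} x y (suc k) =
    trans (cong (_+_ (head x - head y)) (partialSums-⊝ (tail x) (tail y) k))
          (interchange (head x) (head y) (partialSums (tail x) k) (partialSums (tail y) k))

  partialSums-increments : ∀ {n} a (x : Vector ℤ n) k →
    partialSums (increments a x) k ≡ x k - a
  partialSums-increments {suc n} a x zero    = refl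
  partialSums-increments {suc n} a x (suc k) =
    trans (cong (_+_ (head x - a)) (partialSums-increments (head x) (tail x) k))
          (telescope (head x) a (x (suc k)))
    where
    telescope : ∀ x₀ a xₖ → (x₀ - a) + (xₖ - x₀) ≡ xₖ - a
    telescope = ℤ-Solver.solve-∀

  sum-increments : ∀ {n} a (x : Vector ℤ n) → sumℤ (increments a x) ≡ - a
  sum-increments {zero}  a x = drop a
    where
    drop : ∀ a → (0ℤ - a) + 0ℤ ≡ - a
    drop = ℤ-Solver.solve-∀
  sum-increments {suc n} a x =
    trans (cong (_+_ (head x - a)) (sum-increments (head x) (tail x))) (telescope (head x) a)
    where
    telescope : ∀ x₀ a → (x₀ - a) + - x₀ ≡ - a
    telescope = ℤ-Solver.solve-∀

  partialSums-∂ : ∀ {n} (x : Vector ℤ n) → partialSums (∂ x) ≗ x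
  partialSums-∂ x k = trans (partialSums-cong (⊝≗increments 0ℤ x) k)
    (trans (partialSums-increments 0ℤ x k) (ℤₚ.+-identityʳ (x k)))

  sum-∂ : ∀ {n} (x : Vector ℤ n) → RootLattice n (∂ x)
  sum-∂ x = trans (sum-cong-≗ (⊝≗increments 0ℤ x)) (sum-increments 0ℤ x)

  -- The partial sums stop one short of the last coordinate; the total sum supplies what is missing.
  partialSums-sum-injective : ∀ {n} (y z : Vector ℤ (suc n)) →
    partialSums y ≗ partialSums z → sumℤ y ≡ sumℤ z → y ≗ z
  partialSums-sum-injective {zero}  y z _  s zero =
    trans (sym (ℤₚ.+-identityʳ _)) (trans s (ℤₚ.+-identityʳ _))
  partialSums-sum-injective {suc n} y z ps s zero    = ps zero
  partialSums-sum-injective {suc n} y z ps s (suc i) =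
    partialSums-sum-injective (tail y) (tail z)
      (λ k → cancel (ps (suc k))) (cancel s) i
    where
    cancel : ∀ {u v} → head y + u ≡ head z + v → u ≡ v
    cancel {u} {v} eq = +-cancelˡ (head z) u v (trans (cong (_+ u) (sym (ps zero))) eq)

  -- The right inverse comes from the left one: both sides have the same partial sums, and both have
  -- total 0.
  ∂-partialSums : ∀ {n} (y : Vector ℤ (suc n)) → RootLattice n y → ∂ (partialSums y) ≗ y
  ∂-partialSums y Σy≡0 = partialSums-sum-injective (∂ (partialSums y)) y
    (partialSums-∂ (partialSums y)) (trans (sum-∂ (partialSums y)) (sym Σy≡0))

  ∂-injective : ∀ {n} → Injective _≗_ _≗_ (∂ {n})
  ∂-injective {n} {x} {y} ∂x≗∂y k =
    trans (sym (partialSums-∂ x k)) (trans (partialSums-cong ∂x≗∂y k) (partialSums-∂ y k))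

  insertAt-cong : ∀ {n} {x y : Vector ℤ n} i v → x ≗ y → insertAt x i v ≗ insertAt y i v
  insertAt-cong {zero}  zero    v x≗y zero    = refl
  insertAt-cong {suc n} zero    v x≗y zero    = refl
  insertAt-cong {suc n} zero    v x≗y (suc j) = x≗y j
  insertAt-cong {suc n} (suc i) v x≗y zero    = x≗y zero
  insertAt-cong {suc n} (suc i) v x≗y (suc j) = insertAt-cong i v (λ k → x≗y (suc k)) j

  ∂-cong : ∀ {n} {x y : Vector ℤ n} → x ≗ y → ∂ x ≗ ∂ y
  ∂-cong {n} x≗y zero    = cong (_- 0ℤ) (insertAt-cong (fromℕ n) 0ℤ x≗y zero)
  ∂-cong {n} x≗y (suc i) = cong₂ _-_ (insertAt-cong (fromℕ n) 0ℤ x≗y (suc i)) (x≗y i)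

  insertAt-⊕ : ∀ {n} (x y : Vector ℤ n) i →
    insertAt (x ⊕ y) i 0ℤ ≗ insertAt x i 0ℤ ⊕ insertAt y i 0ℤ
  insertAt-⊕ {zero}  x y zero    zero    = refl
  insertAt-⊕ {suc n} x y zero    zero    = refl
  insertAt-⊕ {suc n} x y zero    (suc j) = refl
  insertAt-⊕ {suc n} x y (suc i) zero    = refl
  insertAt-⊕ {suc n} x y (suc i) (suc j) = insertAt-⊕ (tail x) (tail y) i j

  ∂-⊕ : ∀ {n} (x y : Vector ℤ n) → ∂ (x ⊕ y) ≗ ∂ x ⊕ ∂ y
  ∂-⊕ {n} x y i = trans
    (cong₂ _-_ (insertAt-⊕ x y (fromℕ n) i) (0∷-⊕ i))
    (sym (interchange (insertAt x (fromℕ n) 0ℤ i) ((0ℤ ∷ x) i) (insertAt y (fromℕ n) 0ℤ i) ((0ℤ ∷ y) i)))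
    where
    0∷-⊕ : (0ℤ ∷ (x ⊕ y)) ≗ (0ℤ ∷ x) ⊕ (0ℤ ∷ y)
    0∷-⊕ zero    = refl
    0∷-⊕ (suc _) = refl

  sum-zeros : ∀ n → sumℤ {n} (λ _ → 0ℤ) ≡ 0ℤ
  sum-zeros = Sum.sum-replicate-zero ℤₚ.+-0-commutativeMonoid

  sum-e : ∀ {n} a → a ℕ.< n → sumℤ {n} (e (suc a)) ≡ 1ℤ
  sum-e {suc n} zero    _         = cong (_+_ 1ℤ) (sum-zeros n)
  sum-e {suc n} (suc a) (ℕ.s≤s p) = trans (ℤₚ.+-identityˡ _) (sum-e a p)

  sum-⊝ : ∀ {n} (x y : Vector ℤ n) → sumℤ (x ⊝ y) ≡ sumℤ x - sumℤ y
  sum-⊝ {zero}  x y = refl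
  sum-⊝ {suc n} x y = trans (cong (_+_ (head x - head y)) (sum-⊝ (tail x) (tail y)))
    (interchange (head x) (head y) (sumℤ (tail x)) (sumℤ (tail y)))

  partialSums-zeros : ∀ {n} k → partialSums {n} (λ _ → 0ℤ) k ≡ 0ℤ
  partialSums-zeros {suc n} zero    = refl
  partialSums-zeros {suc n} (suc k) = trans (ℤₚ.+-identityˡ _) (partialSums-zeros k)

  partialSums-e : ∀ {n} a k →
    partialSums {n} (e (suc a)) k ≡ (if does (suc a ℕₚ.≤? pos k) then 1ℤ else 0ℤ)
  partialSums-e {suc n} zero    zero    = refl
  partialSums-e {suc n} zero    (suc k) = cong (_+_ 1ℤ) (partialSums-zeros k)
  partialSums-e {suc n} (suc a) zero    = refl
  partialSums-e {suc n} (suc a) (suc k) = trans (ℤₚ.+-identityˡ _) (partialSums-e a k)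

  -- Instead of expanding `∂`, the indicator is recognised as the partial sums [a ≤ k] - [b < k] of
  -- the right-hand side, which has total 0; then `∂-partialSums` applies.
  ∂-𝟙 : ∀ {n} a b → 1 ℕ.≤ a → a ℕ.≤ b → b ℕ.≤ n → ∂ {n} 𝟙[ a , b ] ≗ e a ⊝ e (suc b)
  ∂-𝟙 {n} (suc a) b _ a<b b≤n i = trans
    (∂-cong (λ k → sym (partialSums≡𝟙 k)) i) (∂-partialSums (e (suc a) ⊝ e (suc b)) balanced i)
    where
    balanced : RootLattice n (e (suc a) ⊝ e (suc b))
    balanced = trans (sum-⊝ {suc n} (e (suc a)) (e (suc b)))
      (cong₂ _-_ (sum-e {suc n} a (ℕₚ.m≤n⇒m≤1+n (ℕₚ.≤-trans a<b b≤n))) (sum-e b (ℕ.s≤s b≤n)))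

    difference : ∀ {p} (a<?p : Dec (a ℕ.< p)) (b<?p : Dec (b ℕ.< p)) (p≤?b : Dec (p ℕ.≤ b)) →
      (if does a<?p then 1ℤ else 0ℤ) - (if does b<?p then 1ℤ else 0ℤ)
      ≡ (if does (a<?p ×-dec p≤?b) then 1ℤ else 0ℤ)
    difference (yes _)   (yes b<p) (yes p≤b) = contradiction p≤b (ℕₚ.<⇒≱ b<p)
    difference (yes _)   (yes _)   (no  _)   = refl
    difference (yes _)   (no  _)   (yes _)   = refl
    difference (yes _)   (no  b≮p) (no  p≰b) = contradiction (ℕₚ.≮⇒≥ b≮p) p≰b
    difference (no  a≮p) (yes b<p) _         = contradiction (ℕₚ.<-trans a<b b<p) a≮p
    difference (no  _)   (no  _)   _         = refl

    partialSums≡𝟙 : ∀ k → partialSums (e (suc a) ⊝ e (suc b)) k ≡ 𝟙[ suc a , b ] k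
    partialSums≡𝟙 k = trans (partialSums-⊝ (e (suc a)) (e (suc b)) k)
      (trans (cong₂ _-_ (partialSums-e a k) (partialSums-e b k))
        (difference (suc a ℕₚ.≤? pos k) (suc b ℕₚ.≤? pos k) (pos k ℕₚ.≤? b)))

-- Rational coefficients paired with integer vectors

module Pairing where
  open Sum ℚₚ.+-0-commutativeMonoid using (sum-cong-≗; ∑-distrib-+; sum-remove; sum-replicate-zero)
  open ℚ-Solver.+-*-Solver
  open import Data.Rational.Base using (_+_; _*_; _-_; -_)

  ι : ℤ → ℚ
  ι x = x ℚ./ 1

  -- The normalisation in `ℚ./` does not compute on a variable numerator, so the identity is moved
  -- to unnormalised fractions of denominator 1, where it is a ring identity.
  ι-homo-- : ∀ x y → ι (x ℤ.- y) ≡ ι x - ι y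
  ι-homo-- x y = ℚₚ.toℚᵘ-injective (begin
    ℚ.toℚᵘ (ι (x ℤ.- y))                      ≈⟨ ℚₚ.toℚᵘ-fromℚᵘ (frac (x ℤ.- y)) ⟩
    frac (x ℤ.- y)                            ≈⟨ ℚᵘ.*≡* (rearrange x y) ⟩
    frac x ℚᵘ.- frac y                        ≈⟨ ℚᵘₚ.+-cong (ℚₚ.toℚᵘ-fromℚᵘ (frac x)) (ℚᵘₚ.-‿cong (ℚₚ.toℚᵘ-fromℚᵘ (frac y))) ⟨
    ℚ.toℚᵘ (ι x) ℚᵘ.- ℚ.toℚᵘ (ι y)            ≈⟨ ℚᵘₚ.+-congʳ (ℚ.toℚᵘ (ι x)) (ℚₚ.toℚᵘ-homo‿- (ι y)) ⟨
    ℚ.toℚᵘ (ι x) ℚᵘ.+ ℚ.toℚᵘ (- ι y)          ≈⟨ ℚₚ.toℚᵘ-homo-+ (ι x) (- ι y) ⟨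
    ℚ.toℚᵘ (ι x - ι y)                        ∎)
    where
    open ℚᵘₚ.≃-Reasoning
    frac : ℤ → ℚᵘ.ℚᵘ
    frac z = ℚᵘ.mkℚᵘ z 0
    rearrange : ∀ x y → (x ℤ.- y) ℤ.* 1ℤ ≡ (x ℤ.* 1ℤ ℤ.+ (ℤ.- y) ℤ.* 1ℤ) ℤ.* 1ℤ
    rearrange = ℤ-Solver.solve-∀

  -- `IsRelation B a` says precisely that `pairing a` vanishes on every row of `B`.
  pairing : ∀ {q} → Vector ℚ q → Vector ℤ q → ℚ
  pairing a x = sumℚ (λ j → a j * ι (x j))

  pairing-congʳ : ∀ {q} (a : Vector ℚ q) {x y} → x ≗ y → pairing a x ≡ pairing a y
  pairing-congʳ a x≗y = sum-cong-≗ (λ j → cong (λ z → a j * ι z) (x≗y j))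

  pairing-zeroˡ : ∀ {q} (x : Vector ℤ q) → pairing (λ _ → 0ℚ) x ≡ 0ℚ
  pairing-zeroˡ {q} x =
    trans (sum-cong-≗ (λ j → ℚₚ.*-zeroˡ (ι (x j)))) (sum-replicate-zero q)

  pairing-zeroʳ : ∀ {q} (a : Vector ℚ q) → pairing a (λ _ → 0ℤ) ≡ 0ℚ
  pairing-zeroʳ {q} a = trans (sum-cong-≗ (λ j → ℚₚ.*-zeroʳ (a j))) (sum-replicate-zero q)

  pairing-+ˡ : ∀ {q} (a b : Vector ℚ q) x →
    pairing (λ j → a j + b j) x ≡ pairing a x + pairing b x
  pairing-+ˡ a b x = trans (sum-cong-≗ (λ j → ℚₚ.*-distribʳ-+ (ι (x j)) (a j) (b j)))
                           (∑-distrib-+ (λ j → a j * ι (x j)) (λ j → b j * ι (x j)))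

  pairing-⊝ʳ : ∀ {q} (a : Vector ℚ q) x y → pairing a (x ⊝ y) ≡ pairing a x - pairing a y
  pairing-⊝ʳ {zero}  a x y = refl
  pairing-⊝ʳ {suc q} a x y = trans
    (cong₂ (λ u v → head a * u + v) (ι-homo-- (head x) (head y)) (pairing-⊝ʳ (tail a) (tail x) (tail y)))
    (solve 5 (λ a x y u v → a :* (x :- y) :+ (u :- v) := (a :* x :+ u) :- (a :* y :+ v)) refl
      (head a) (ι (head x)) (ι (head y)) (pairing (tail a) (tail x)) (pairing (tail a) (tail y)))

  sum-concentrated : ∀ {q} (t : Vector ℚ q) i → (∀ j → j ≢ i → t j ≡ 0ℚ) → sumℚ t ≡ t i
  sum-concentrated {suc q} t i vanish = trans (sum-remove {i = i} t)
    (trans (cong (t i +_)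
      (trans (sum-cong-≗ (λ j → vanish (punchIn i j) (Finₚ.punchInᵢ≢i i j))) (sum-replicate-zero q)))
      (ℚₚ.+-identityʳ (t i)))

  single : ∀ {q} → Fin q → ℚ → Vector ℚ q
  single f s j = if does (j Finₚ.≟ f) then s else 0ℚ

  single-same : ∀ {q} (f : Fin q) s → single f s f ≡ s
  single-same f s = cong (λ b → if b then s else 0ℚ) (dec-true (f Finₚ.≟ f) refl)

  single-other : ∀ {q} {f j : Fin q} s → j ≢ f → single f s j ≡ 0ℚ
  single-other {f = f} {j} s j≢f = cong (λ b → if b then s else 0ℚ) (dec-false (j Finₚ.≟ f) j≢f)

  pairing-single : ∀ {q} (f : Fin q) s x → pairing (single f s) x ≡ s * ι (x f)
  pairing-single f s x = trans
    (sum-concentrated (λ j → single f s j * ι (x j)) f (λ j j≢f → trans (cong (_* ι (x j)) (single-other s j≢f)) (ℚₚ.*-zeroˡ (ι (x j)))))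
    (cong (_* ι (x f)) (single-same f s))

-- Unit vectors, and injectivity of vectors extended by one entry

module UnitVectors where
  e-same : ∀ {n} a (v : Fin n) → a ≡ pos v → e a v ≡ 1ℤ
  e-same a v eq = cong (λ b → if b then 1ℤ else 0ℤ) (dec-true (a ℕₚ.≟ pos v) eq)

  e-other : ∀ {n} a (v : Fin n) → a ≢ pos v → e a v ≡ 0ℤ
  e-other a v neq = cong (λ b → if b then 1ℤ else 0ℤ) (dec-false (a ℕₚ.≟ pos v) neq)

  pos-injective : ∀ {n} {u v : Fin n} → pos u ≡ pos v → u ≡ v
  pos-injective = Finₚ.toℕ-injective ∘ ℕₚ.suc-injective

insertAt-inject₁ : ∀ {A : Set} {n} (xs : Vector A n) v i →
  insertAt xs (fromℕ n) v (inject₁ i) ≡ xs i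
insertAt-inject₁ xs v zero    = refl
insertAt-inject₁ xs v (suc i) = insertAt-inject₁ (tail xs) v i

insertAt-fromℕ : ∀ {A : Set} {n} (xs : Vector A n) v → insertAt xs (fromℕ n) v (fromℕ n) ≡ v
insertAt-fromℕ {n = n} xs v = Vectorₚ.insertAt-lookup xs (fromℕ n) v

∷-injective : ∀ {A : Set} {n} {x : A} {xs : Vector A n} →
  (∀ i → xs i ≢ x) → Injective _≡_ _≡_ xs → Injective _≡_ _≡_ (x ∷ xs)
∷-injective x∉xs inj {zero}  {zero}  _  = refl
∷-injective x∉xs inj {zero}  {suc j} eq = contradiction (sym eq) (x∉xs j)
∷-injective x∉xs inj {suc i} {zero}  eq = contradiction eq (x∉xs i)
∷-injective x∉xs inj {suc i} {suc j} eq = cong suc (inj eq)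

insertAt-fromℕ-injective : ∀ {A : Set} {n} {x : A} {xs : Vector A n} →
  (∀ i → xs i ≢ x) → Injective _≡_ _≡_ xs → Injective _≡_ _≡_ (insertAt xs (fromℕ n) x)
insertAt-fromℕ-injective {n = n} {x} {xs} x∉xs inj {i} {j} = go (view i) (view j)
  where
  go : ∀ {i j} → View i → View j →
    insertAt xs (fromℕ n) x i ≡ insertAt xs (fromℕ n) x j → i ≡ j
  go ‵fromℕ       ‵fromℕ       _  = refl
  go ‵fromℕ       (‵inject₁ j) eq = contradiction
    (trans (sym (insertAt-inject₁ xs x j)) (trans (sym eq) (insertAt-fromℕ xs x))) (x∉xs j)
  go (‵inject₁ i) ‵fromℕ       eq = contradiction
    (trans (sym (insertAt-inject₁ xs x i)) (trans eq (insertAt-fromℕ xs x))) (x∉xs i)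
  go (‵inject₁ i) (‵inject₁ j) eq = cong inject₁
    (inj (trans (sym (insertAt-inject₁ xs x i)) (trans eq (insertAt-inject₁ xs x j))))

-- From a cycle to a linear relation

module CycleRelation {n N q : ℕ} (G : Multigraph N q) (B : Matrix n q)
  (φ : Fin n → Fin N → ℤ)
  (gradient : (k : Fin n) (j : Fin q) → B k j ≡ φ k (Multigraph.src G j) ℤ.- φ k (Multigraph.tgt G j)) where
  open Multigraph G
  open Pairing
  open import Data.Rational.Base using (_+_; _*_; _-_; -_)
  open ℚ-Solver.+-*-Solver

  -- Edges are oriented, but a cycle may traverse them either way; the factor `s` = ± 1 corrects the
  -- direction.
  orient : ∀ {f u v} → Joins f u v →
    ∃ λ s → s ≢ 0ℚ × ∀ k → s * ι (B k f) ≡ ι (φ k u) - ι (φ k v)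
  orient {f} (inj₁ (refl , refl)) = 1ℚ , (λ ()) , λ k →
    trans (ℚₚ.*-identityˡ (ι (B k f))) (trans (cong ι (gradient k f)) (ι-homo-- (φ k (src f)) (φ k (tgt f))))
  orient {f} (inj₂ (refl , refl)) = - 1ℚ , (λ ()) , λ k →
    trans (cong (- 1ℚ *_) (trans (cong ι (gradient k f)) (ι-homo-- (φ k (src f)) (φ k (tgt f)))))
      (solve 2 (λ x y → (:- con 1ℚ) :* (x :- y) := y :- x) refl (ι (φ k (src f))) (ι (φ k (tgt f))))

  -- Row k is the gradient of the potential `φ k`, so the correctly signed sum along a walk
  -- telescopes to the difference of the potentials at its ends.
  walk : ∀ ℓ (vertex : Fin (suc ℓ) → Fin N) (edge : Fin ℓ → Fin q) →
    (∀ i → Joins (edge i) (vertex (inject₁ i)) (vertex (suc i))) →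
    ∃ λ a → (∀ j → (∀ i → edge i ≢ j) → a j ≡ 0ℚ) ×
      ∀ k → pairing a (B k) ≡ ι (φ k (vertex zero)) - ι (φ k (vertex (fromℕ ℓ)))
  walk zero vertex edge step = (λ _ → 0ℚ) , (λ _ _ → refl) , λ k →
    trans (pairing-zeroˡ (B k)) (sym (ℚₚ.+-inverseʳ (ι (φ k (vertex zero)))))
  walk (suc ℓ) vertex edge step =
    let s , _ , first = orient (step zero)
        a , off , rest = walk ℓ (tail vertex) (tail edge) (step ∘ suc)
    in (λ j → single (edge zero) s j + a j)
     , (λ j j∉ → cong₂ _+_ (single-other s (j∉ zero ∘ sym)) (off j (j∉ ∘ suc)))
     , λ k → trans (pairing-+ˡ (single (edge zero) s) a (B k))
         (trans (cong₂ _+_ (trans (pairing-single (edge zero) s (B k)) (first k)) (rest k))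
           (solve 3 (λ x y z → (x :- y) :+ (y :- z) := x :- z) refl
             (ι (φ k (vertex zero))) (ι (φ k (vertex (suc zero)))) (ι (φ k (vertex (fromℕ (suc ℓ)))))))

  -- The closing edge is added to the walk separately. It differs from all edges of the walk, so its
  -- coefficient ± 1 cannot be cancelled and the relation is nontrivial. For a loop the walk is
  -- empty.
  relation : (C : Cycle) → ∃ λ a → IsRelation B a ×
    (∀ j → (∀ i → Cycle.edge C i ≢ j) → a j ≡ 0ℚ) × ∃ λ i → a (Cycle.edge C i) ≢ 0ℚ
  relation C =
    let s , s≢0 , last = orient close
        a , off , rest = walk ℓ vertex (edge ∘ inject₁) step
        eₗ = edge (fromℕ ℓ)
        aₗ≡0 = off eₗ (λ i eq → Finₚ.fromℕ≢inject₁ (sym (edge-injective eq)))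
    in (λ j → single eₗ s j + a j)
     , (λ k → trans (pairing-+ˡ (single eₗ s) a (B k))
         (trans (cong₂ _+_ (trans (pairing-single eₗ s (B k)) (last k)) (rest k))
           (solve 2 (λ x y → (x :- y) :+ (y :- x) := con 0ℚ) refl
             (ι (φ k (vertex (fromℕ ℓ)))) (ι (φ k (vertex zero))))))
     , (λ j j∉ → cong₂ _+_ (single-other s (j∉ (fromℕ ℓ) ∘ sym)) (off j (j∉ ∘ inject₁)))
     , fromℕ ℓ
     , λ eq → s≢0 (trans (sym (trans (cong₂ _+_ (single-same eₗ s) aₗ≡0) (ℚₚ.+-identityʳ s))) eq)
    where open Cycle C

-- From balanced coefficients to a cycle in their support

module CycleSearch {N q : ℕ} (G : Multigraph N q) (a : Vector ℚ q)
  (balanced : (v : Fin N) → Pairing.pairing a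
    (λ j → e (pos (Multigraph.src G j)) v ℤ.- e (pos (Multigraph.tgt G j)) v) ≡ 0ℚ) where
  open Multigraph G
  open Pairing
  open UnitVectors
  open import Data.Rational.Base using (_*_)
  open ℚ-Solver.+-*-Solver

  Active : Fin q → Set
  Active j = a j ≢ 0ℚ

  active? : ∀ j → Dec (Active j)
  active? j = ¬? (a j ℚₚ.≟ 0ℚ)

  ActiveCycle : Set
  ActiveCycle = ∃ λ (C : Cycle) → ∀ i → Active (Cycle.edge C i)

  Touches : Fin q → Fin N → Set
  Touches f v = src f ≡ v ⊎ tgt f ≡ v

  -- Paths grow at `vertex zero`, so that prolonging one is a plain `∷`; the old end is
  -- `vertex (fromℕ ℓ)`.
  record Path (ℓ : ℕ) : Set where
    field
      vertex           : Fin (suc ℓ) → Fin N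
      edge             : Fin ℓ → Fin q
      vertex-injective : Injective _≡_ _≡_ vertex
      edge-injective   : Injective _≡_ _≡_ edge
      step             : ∀ i → Joins (edge i) (vertex (inject₁ i)) (vertex (suc i))
      active           : ∀ i → Active (edge i)

  dropLast : ∀ {ℓ} → Path (suc ℓ) → Path ℓ
  dropLast P = record
    { vertex           = vertex ∘ inject₁
    ; edge             = edge ∘ inject₁
    ; vertex-injective = Finₚ.inject₁-injective ∘ vertex-injective
    ; edge-injective   = Finₚ.inject₁-injective ∘ edge-injective
    ; step             = step ∘ inject₁
    ; active           = active ∘ inject₁
    }
    where open Path P

  closeAtEnd : ∀ {ℓ} (P : Path ℓ) f → Active f → (∀ i → Path.edge P i ≢ f) →
    Joins f (Path.vertex P (fromℕ ℓ)) (Path.vertex P zero) → ActiveCycle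
  closeAtEnd {ℓ} P f f-active f-new f-joins = record
    { ℓ                = ℓ
    ; vertex           = vertex
    ; edge             = edges
    ; vertex-injective = vertex-injective
    ; edge-injective   = insertAt-fromℕ-injective f-new edge-injective
    ; step             = λ i → subst (λ g → Joins g (vertex (inject₁ i)) (vertex (suc i)))
                                 (sym (insertAt-inject₁ edge f i)) (step i)
    ; close            = subst (λ g → Joins g (vertex (fromℕ ℓ)) (vertex zero))
                           (sym (insertAt-fromℕ edge f)) f-joins
    } , λ i → edges-active (view i)
    where
    open Path P
    edges : Fin (suc ℓ) → Fin q
    edges = insertAt edge (fromℕ ℓ) f
    edges-active : ∀ {i} → View i → Active (edges i)
    edges-active ‵fromℕ       = subst Active (sym (insertAt-fromℕ edge f)) f-active
    edges-active (‵inject₁ i) = subst Active (sym (insertAt-inject₁ edge f i)) (active i)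

  -- When `f` returns to an inner vertex, the path is cut back from its old end until that vertex is
  -- last. If the vertex is the neighbour of `vertex zero`, two parallel edges result.
  close : ∀ {ℓ} (P : Path ℓ) f → Active f → (∀ i → Path.edge P i ≢ f) →
    ∀ k → Joins f (Path.vertex P k) (Path.vertex P zero) → ActiveCycle
  close {zero}  P f f-active f-new zero f-joins = closeAtEnd P f f-active f-new f-joins
  close {suc ℓ} P f f-active f-new k    f-joins with view k
  ... | ‵fromℕ     = closeAtEnd P f f-active f-new f-joins
  ... | ‵inject₁ i = close (dropLast P) f f-active (f-new ∘ inject₁) i f-joins

  endpoint : ∀ {f u v x y} → Joins f u v → Joins f x y → v ≡ x ⊎ v ≡ y
  endpoint (inj₁ (_ , p)) (inj₁ (_ , r)) = inj₂ (trans (sym p) r)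
  endpoint (inj₁ (_ , p)) (inj₂ (_ , r)) = inj₁ (trans (sym p) r)
  endpoint (inj₂ (p , _)) (inj₁ (r , _)) = inj₁ (trans (sym p) r)
  endpoint (inj₂ (p , _)) (inj₂ (r , _)) = inj₂ (trans (sym p) r)

  otherEnd : ∀ {f v} → Touches f v → ∃ λ u → Joins f u v
  otherEnd {f} (inj₁ src≡v) = tgt f , inj₂ (src≡v , refl)
  otherEnd {f} (inj₂ tgt≡v) = src f , inj₁ (refl , tgt≡v)

  touches : ∀ {f u v} → Joins f u v → Touches f u
  touches (inj₁ (p , _)) = inj₁ p
  touches (inj₂ (_ , p)) = inj₂ p

  module _ (loopless : ∀ f → Active f → src f ≢ tgt f) where

    -- Were g the only active edge at v, the balance at v would read ± a g ≡ 0.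
    escape : ∀ {g v} → Active g → Touches g v → ∃ λ f → f ≢ g × Active f × Touches f v
    escape {g} {v} g-active g-at-v
      with Finₚ.any? (λ f → ¬? (f Finₚ.≟ g) ×-dec active? f ×-dec
                            ((src f Finₚ.≟ v) ⊎-dec (tgt f Finₚ.≟ v)))
    ... | yes found = found
    ... | no  none  = contradiction (a-g≡0 g-at-v) g-active
      where
      incidence : Fin q → ℤ
      incidence j = e (pos (src j)) v ℤ.- e (pos (tgt j)) v

      others-vanish : ∀ j → j ≢ g → a j * ι (incidence j) ≡ 0ℚ
      others-vanish j j≢g with a j ℚₚ.≟ 0ℚ
      ... | yes a≡0 = trans (cong (_* ι (incidence j)) a≡0) (ℚₚ.*-zeroˡ (ι (incidence j)))
      ... | no  a≢0 = trans (cong (λ z → a j * ι z)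
        (cong₂ ℤ._-_
          (e-other (pos (src j)) v (λ eq → none (j , j≢g , a≢0 , inj₁ (pos-injective eq))))
          (e-other (pos (tgt j)) v (λ eq → none (j , j≢g , a≢0 , inj₂ (pos-injective eq))))))
        (ℚₚ.*-zeroʳ (a j))

      balance-at-v : a g * ι (incidence g) ≡ 0ℚ
      balance-at-v = trans (sym (sum-concentrated (λ j → a j * ι (incidence j)) g others-vanish)) (balanced v)

      a-g≡0 : Touches g v → a g ≡ 0ℚ
      a-g≡0 (inj₁ src≡v) = trans (sym (ℚₚ.*-identityʳ (a g))) (trans (cong (λ z → a g * ι z) (sym
        (cong₂ ℤ._-_ (e-same (pos (src g)) v (cong pos src≡v))
          (e-other (pos (tgt g)) v (λ eq → loopless g g-active (trans src≡v (sym (pos-injective eq))))))))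
        balance-at-v)
      a-g≡0 (inj₂ tgt≡v) = trans
        (solve 1 (λ x → x := (:- con 1ℚ) :* (x :* (:- con 1ℚ))) refl (a g))
        (cong (ℚ.- 1ℚ *_) (trans (cong (λ z → a g * ι z) (sym
          (cong₂ ℤ._-_
            (e-other (pos (src g)) v (λ eq → loopless g g-active (trans (pos-injective eq) (sym tgt≡v))))
            (e-same (pos (tgt g)) v (cong pos tgt≡v)))))
          balance-at-v))

    extend : ∀ {ℓ} (P : Path ℓ) f u → Active f → (∀ i → Path.edge P i ≢ f) →
      (∀ k → Path.vertex P k ≢ u) → Joins f u (Path.vertex P zero) → Path (suc ℓ)
    extend P f u f-active f-new u-new f-joins = record
      { vertex           = u ∷ vertex
      ; edge             = f ∷ edge
      ; vertex-injective = ∷-injective u-new vertex-injective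
      ; edge-injective   = ∷-injective f-new edge-injective
      ; step             = λ { zero → f-joins ; (suc i) → step i }
      ; active           = λ { zero → f-active ; (suc i) → active i }
      }
      where open Path P

    advance : ∀ {ℓ} → Path (suc ℓ) → ActiveCycle ⊎ Path (suc (suc ℓ))
    advance {ℓ} P =
      let f , f≢g , f-active , f-at-v = escape (active zero) (touches (step zero))
          u , f-joins = otherEnd f-at-v
      in next f u f-active (f-new f u f≢g f-joins) f-joins (Finₚ.any? (λ k → vertex k Finₚ.≟ u))
      where
      open Path P
      -- Every edge after the first joins two vertices other than `vertex zero`, whereas `f` ends
      -- there.
      f-new : ∀ f u → f ≢ edge zero → Joins f u (vertex zero) → ∀ i → edge i ≢ f
      f-new f u f≢g f-joins zero    eq   = f≢g (sym eq)
      f-new f u f≢g f-joins (suc i) refl = [ (λ eq → contradiction (vertex-injective eq) λ ())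
        , (λ eq → contradiction (vertex-injective eq) λ ()) ]′ (endpoint f-joins (step (suc i)))

      next : ∀ f u → Active f → (∀ i → edge i ≢ f) → Joins f u (vertex zero) →
        Dec (∃ λ k → vertex k ≡ u) → ActiveCycle ⊎ Path (suc (suc ℓ))
      next f _ f-active new f-joins (yes (k , refl)) = inj₁ (close P f f-active new k f-joins)
      next f u f-active new f-joins (no u-new) =
        inj₂ (extend P f u f-active new (λ k eq → u-new (k , eq)) f-joins)

    -- `d` is fuel: the path has ℓ + 2 distinct vertices among N, so N ≤ ℓ is impossible once `d` is
    -- 0.
    grow : ∀ d {ℓ} → N ℕ.≤ d ℕ.+ ℓ → Path (suc ℓ) → ActiveCycle
    grow zero        N≤ P = contradiction
      (ℕₚ.≤-trans (Finₚ.injective⇒≤ (Path.vertex-injective P)) N≤) (ℕₚ.<⇒≱ (ℕₚ.m<n⇒m<1+n ℕₚ.≤-refl))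
    grow (suc d) {ℓ} N≤ P =
      [ (λ C → C) , grow d (subst (N ℕ.≤_) (sym (ℕₚ.+-suc d ℓ)) N≤) ]′ (advance P)

    singleEdge : ∀ f → Active f → Path 1
    singleEdge f f-active = record
      { vertex           = src f ∷ λ _ → tgt f
      ; edge             = λ _ → f
      ; vertex-injective = ∷-injective (λ _ eq → loopless f f-active (sym eq)) (λ { {zero} {zero} _ → refl })
      ; edge-injective   = λ { {zero} {zero} _ → refl }
      ; step             = λ { zero → inj₁ (refl , refl) }
      ; active           = λ _ → f-active
      }

  -- At a loop the two unit vectors cancel, so balance says nothing about its coefficient. An active
  -- loop is therefore returned as a cycle of length 1 before `escape` is used.
  activeCycle : ∀ f → Active f → ActiveCycle
  activeCycle f f-active
    with Finₚ.any? (λ g → active? g ×-dec (src g Finₚ.≟ tgt g))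
  ... | yes (g , g-active , loop) = record
        { ℓ                = 0
        ; vertex           = λ _ → src g
        ; edge             = λ _ → g
        ; vertex-injective = λ { {zero} {zero} _ → refl }
        ; edge-injective   = λ { {zero} {zero} _ → refl }
        ; step             = λ ()
        ; close            = inj₁ (refl , sym loop)
        } , λ _ → g-active
  ... | no none = grow loopless N (ℕₚ.m≤m+n N 0) (singleEdge loopless f f-active)
    where
    loopless : ∀ g → Active g → src g ≢ tgt g
    loopless g g-active loop = none (g , g-active , loop)

-- The column matroid as a cycle matroid

module GraphicMatroid {n q : ℕ} (B : Matrix n q) (G : Multigraph (suc n) q) (edges : G hasEdges∂ B) where
  open Multigraph G
  open Boundary
  open Pairing

  -- `partialSums` undoes `∂`. The potential of row k at a vertex u is 1 if `pos u` ≤ `pos k` and 0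
  -- otherwise, so row k records how the edges cross the cut after the first `pos k` vertices.
  column-gradient : ∀ k j →
    B k j ≡ partialSums (e (pos (src j))) k ℤ.- partialSums (e (pos (tgt j))) k
  column-gradient k j = trans (sym (partialSums-∂ (column B j) k))
    (trans (partialSums-cong (edges j) k) (partialSums-⊝ (e (pos (src j))) (e (pos (tgt j))) k))

  -- Coordinate v of `∂` is the difference of two consecutive rows, a zero row being added at either
  -- end, and the relation kills both.
  relation-balanced : ∀ a → IsRelation B a → ∀ v →
    pairing a (λ j → e (pos (src j)) v ℤ.- e (pos (tgt j)) v) ≡ 0ℚ
  relation-balanced a rel v = trans (pairing-congʳ a (λ j → sym (edges j v)))
    (trans (pairing-⊝ʳ a (λ j → insertAt (column B j) (fromℕ n) 0ℤ v) (λ j → (0ℤ ∷ column B j) v))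
      (cong₂ ℚ._-_ (upper (view v)) (lower v)))
    where
    upper : ∀ {v} → View v → pairing a (λ j → insertAt (column B j) (fromℕ n) 0ℤ v) ≡ 0ℚ
    upper ‵fromℕ = trans (pairing-congʳ a (λ j → insertAt-fromℕ (column B j) 0ℤ)) (pairing-zeroʳ a)
    upper (‵inject₁ i) = trans (pairing-congʳ a (λ j → insertAt-inject₁ (column B j) 0ℤ i)) (rel i)
    lower : ∀ v → pairing a (λ j → (0ℤ ∷ column B j) v) ≡ 0ℚ
    lower zero    = pairing-zeroʳ a
    lower (suc i) = rel i

  columnMatroid⇔cycleMatroid : ∀ S → columnMatroid B S ⇔ cycleMatroid G S
  columnMatroid⇔cycleMatroid S = mk⇔ acyclic independent
    where
    acyclic : columnMatroid B S → cycleMatroid G S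
    acyclic indep (C , C⊆S) =
      let a , rel , off-C , i , aᵢ≢0 = CycleRelation.relation G B
            (λ k u → partialSums (e (pos u)) k) column-gradient C
      in aᵢ≢0 (indep a (λ j j∉S → off-C j (λ i eq → j∉S (subst (_∈ S) eq (C⊆S i)))) rel
           (Cycle.edge C i))

    independent : cycleMatroid G S → columnMatroid B S
    -- `cycleMatroid` only denies a cycle, so the argument is by contradiction; it is constructive
    -- because equality in `ℚ` and membership in `S` are decidable.
    independent noCycle a off-S rel j = decidable-stable (a j ℚₚ.≟ 0ℚ) λ aⱼ≢0 →
      let C , C-active = CycleSearch.activeCycle G a (relation-balanced a rel) j aⱼ≢0
      in noCycle (C , λ i → decidable-stable (Cycle.edge C i Subsetₚ.∈? S)
           (λ ∉S → C-active i (off-S (Cycle.edge C i) ∉S)))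

  independent⇔forest : LinearlyIndependentColumns B ⇔ Forest G
  independent⇔forest = mk⇔
    (λ indep C → to (λ a _ → indep a) (C , λ i → Subsetₚ.∈⊤))
    (λ forest a → from (λ (C , _) → forest C) a (λ j j∉⊤ → contradiction Subsetₚ.∈⊤ j∉⊤))
    where open Equivalence (columnMatroid⇔cycleMatroid ⊤)

-- Prefixes, suffixes and monotone indicators

module Intervals where
  -- The cut point k may be 0 or n, so each kind contains the empty and the full interval: the
  -- shapes that a monotone condition can produce. `interval-trichotomy` separates the degenerate
  -- cases.
  IsPrefix IsSuffix IsInterval : ∀ {n} → Vector ℤ n → Set
  IsPrefix {n} x = ∃ λ k → k ℕ.≤ n × x ≗ 𝟙[ 1 , k ]
  IsSuffix {n} x = ∃ λ k → k ℕ.≤ n × x ≗ 𝟙[ suc k , n ]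
  IsInterval x = IsPrefix x ⊎ IsSuffix x

  𝟙-inside : ∀ {n} a b (i : Fin n) → a ℕ.≤ pos i → pos i ℕ.≤ b → 𝟙[ a , b ] i ≡ 1ℤ
  𝟙-inside a b i a≤ ≤b = cong (λ b → if b then 1ℤ else 0ℤ)
    (dec-true ((a ℕₚ.≤? pos i) ×-dec (pos i ℕₚ.≤? b)) (a≤ , ≤b))

  𝟙-empty : ∀ {n} k → IsZero {n} 𝟙[ suc k , k ]
  𝟙-empty k i = cong (λ b → if b then 1ℤ else 0ℤ)
    (dec-false ((suc k ℕₚ.≤? pos i) ×-dec (pos i ℕₚ.≤? k)) λ (k<p , p≤k) → ℕₚ.<⇒≱ k<p p≤k)

  𝟙-full : ∀ {n} → (λ _ → 1ℤ) ≗ 𝟙[_,_] {n} 1 n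
  𝟙-full {n} i = sym (𝟙-inside 1 n i (ℕ.s≤s ℕ.z≤n) (Finₚ.toℕ<n i))

  -- Besides fixing the values of `x`, this decides `P` at every index, which lets the recursions
  -- below branch on it.
  Indicates : ∀ {n} → (Fin n → Set) → Vector ℤ n → Set
  Indicates P x = ∀ i → (P i × x i ≡ 1ℤ) ⊎ (¬ P i × x i ≡ 0ℤ)

  indicator-one : ∀ {n} {P : Fin n → Set} {x} → Indicates P x → ∀ {i} → P i → x i ≡ 1ℤ
  indicator-one ind {i} Pᵢ = [ proj₂ , (λ (¬Pᵢ , _) → contradiction Pᵢ ¬Pᵢ) ]′ (ind i)

  indicator-zero : ∀ {n} {P : Fin n → Set} {x} → Indicates P x → ∀ {i} → ¬ P i → x i ≡ 0ℤ
  indicator-zero ind {i} ¬Pᵢ = [ (λ (Pᵢ , _) → contradiction Pᵢ ¬Pᵢ) , proj₂ ]′ (ind i)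

  upClosed⇒suffix : ∀ {n} (P : Fin n → Set) x → Indicates P x →
    (∀ i j → toℕ i ℕ.≤ toℕ j → P i → P j) → IsSuffix x
  upClosed⇒suffix {zero}  P x ind up = 0 , ℕ.z≤n , λ ()
  upClosed⇒suffix {suc n} P x ind up = [ all , later ]′ (ind zero)
    where
    all : P zero × x zero ≡ 1ℤ → IsSuffix x
    all (P₀ , _) = 0 , ℕ.z≤n , λ i →
      trans (indicator-one ind (up zero i ℕ.z≤n P₀)) (𝟙-full i)
    later : ¬ P zero × x zero ≡ 0ℤ → IsSuffix x
    later (_ , x₀≡0) =
      let k , k≤n , eq = upClosed⇒suffix (P ∘ suc) (tail x) (ind ∘ suc)
                           (λ i j i≤j → up (suc i) (suc j) (ℕ.s≤s i≤j))
      in suc k , ℕ.s≤s k≤n , λ { zero → x₀≡0 ; (suc i) → eq i }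

  downClosed⇒prefix : ∀ {n} (P : Fin n → Set) x → Indicates P x →
    (∀ i j → toℕ i ℕ.≤ toℕ j → P j → P i) → IsPrefix x
  downClosed⇒prefix {zero}  P x ind down = 0 , ℕ.z≤n , λ ()
  downClosed⇒prefix {suc n} P x ind down = [ later , none ]′ (ind zero)
    where
    none : ¬ P zero × x zero ≡ 0ℤ → IsPrefix x
    none (¬P₀ , _) = 0 , ℕ.z≤n , λ i →
      trans (indicator-zero ind (¬P₀ ∘ down zero i ℕ.z≤n)) (sym (𝟙-empty 0 i))
    later : P zero × x zero ≡ 1ℤ → IsPrefix x
    later (_ , x₀≡1) =
      let k , k≤n , eq = downClosed⇒prefix (P ∘ suc) (tail x) (ind ∘ suc)
                           (λ i j i≤j → down (suc i) (suc j) (ℕ.s≤s i≤j))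
      in suc k , ℕ.s≤s k≤n , λ { zero → x₀≡1 ; (suc i) → eq i }

  interval-trichotomy : ∀ {n} {x : Vector ℤ n} → IsInterval x → ¬ IsZero x →
    IsProperPrefix x ⊎ IsProperSuffix x ⊎ IsFull x
  interval-trichotomy {x = x} (inj₁ (zero , _ , eq)) x≢0 =
    contradiction (λ i → trans (eq i) (𝟙-empty 0 i)) x≢0
  interval-trichotomy {n} {x} (inj₁ (suc k , k≤n , eq)) x≢0 =
    [ (λ k<n → inj₁ (suc k , ℕ.s≤s ℕ.z≤n , k<n , eq))
    , (λ k≡n → inj₂ (inj₂ (subst (λ k → x ≗ 𝟙[ 1 , k ]) k≡n eq)))
    ]′ (ℕₚ.m≤n⇒m<n∨m≡n k≤n)
  interval-trichotomy (inj₂ (zero , _ , eq)) x≢0 = inj₂ (inj₂ eq)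
  interval-trichotomy {n} {x} (inj₂ (suc k , k≤n , eq)) x≢0 =
    [ (λ k<n → inj₂ (inj₁ (suc k , ℕ.s≤s ℕ.z≤n , k<n , eq)))
    , (λ k≡n → contradiction
        (λ i → trans (subst (λ k → x ≗ 𝟙[ suc k , n ]) k≡n eq i) (𝟙-empty n i)) x≢0)
    ]′ (ℕₚ.m≤n⇒m<n∨m≡n k≤n)

  isZero? : ∀ {n} (x : Vector ℤ n) → Dec (IsZero x)
  isZero? x = Finₚ.all? (λ i → x i ℤₚ.≟ 0ℤ)

  nonzero⇒nonempty : ∀ {n} {x : Vector ℤ n} → ¬ IsZero x → 1 ℕ.≤ n
  nonzero⇒nonempty {zero}  x≢0 = contradiction (λ ()) x≢0
  nonzero⇒nonempty {suc n} x≢0 = ℕ.s≤s ℕ.z≤n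

-- Intervals as oriented edges

module Arcs where
  open Boundary
  open UnitVectors
  open Intervals

  vertexAt : ∀ {N} a → 1 ℕ.≤ a → a ℕ.≤ N → ∃ λ (v : Fin N) → pos v ≡ a
  vertexAt (suc a) _ a<N = fromℕ< a<N , cong suc (Finₚ.toℕ-fromℕ< a<N)

  Arc : ∀ {n} → Vector ℤ n → Set
  Arc {n} x = ∃₂ λ (u v : Fin (suc n)) → ∂ x ≗ e (pos u) ⊝ e (pos v)

  interval⇒arc : ∀ {n} {x : Vector ℤ n} a b → 1 ℕ.≤ a → a ℕ.≤ b → b ℕ.≤ n →
    x ≗ 𝟙[ a , b ] → Arc x
  interval⇒arc {n} {x} a b 1≤a a≤b b≤n eq =
    let u , pos-u = vertexAt a 1≤a (ℕₚ.m≤n⇒m≤1+n (ℕₚ.≤-trans a≤b b≤n))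
        v , pos-v = vertexAt (suc b) (ℕ.s≤s ℕ.z≤n) (ℕ.s≤s b≤n)
    in u , v , λ i → trans (∂-cong eq i) (trans (∂-𝟙 a b 1≤a a≤b b≤n i)
         (cong₂ (λ a b → e a i ℤ.- e b i) (sym pos-u) (sym pos-v)))

  ∂-zero : ∀ {n} {x : Vector ℤ n} → IsZero x → IsZero (∂ x)
  ∂-zero {n} x≡0 v = trans (∂-cong (λ k → trans (x≡0 k) (sym (partialSums-zeros k))) v)
    (∂-partialSums (λ _ → 0ℤ) (sum-zeros (suc n)) v)

  arc : ∀ {n} {x : Vector ℤ n} → IsInterval x → Arc x
  arc {n} {x} x-interval with isZero? x
  -- A zero column leaves the base point of its loop free; the first vertex is chosen.
  ... | yes x≡0 = zero , zero , λ i → trans (∂-zero x≡0 i) (sym (ℤₚ.+-inverseʳ (e 1 i)))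
  ... | no  x≢0 with interval-trichotomy x-interval x≢0
  ...   | inj₁ (k , 1≤k , k<n , eq)        = interval⇒arc 1 k ℕₚ.≤-refl 1≤k (ℕₚ.<⇒≤ k<n) eq
  ...   | inj₂ (inj₁ (k , 1≤k , k<n , eq)) = interval⇒arc (suc k) n (ℕ.s≤s ℕ.z≤n) k<n ℕₚ.≤-refl eq
  ...   | inj₂ (inj₂ eq)                   = interval⇒arc 1 n ℕₚ.≤-refl (nonzero⇒nonempty x≢0) ℕₚ.≤-refl eq

  e-binary : ∀ {n} a (v : Fin n) → e a v ≡ 0ℤ ⊎ e a v ≡ 1ℤ
  e-binary a v with a ℕₚ.≟ pos v
  ... | yes a≡v = inj₂ (e-same a v a≡v)
  ... | no  a≢v = inj₁ (e-other a v a≢v)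

  difference-one : ∀ {n} a b (v : Fin n) → e a v ℤ.- e b v ≡ 1ℤ → a ≡ pos v
  difference-one a b v eq = decidable-stable (a ℕₚ.≟ pos v) λ a≢v →
    [ (λ b≡0 → contradiction (trans (sym (cong₂ ℤ._-_ (e-other a v a≢v) b≡0)) eq) λ ())
    , (λ b≡1 → contradiction (trans (sym (cong₂ ℤ._-_ (e-other a v a≢v) b≡1)) eq) λ ())
    ]′ (e-binary b v)

  difference-swap : ∀ {n} a b (v : Fin n) → e a v ℤ.- e b v ≡ -1ℤ → e b v ℤ.- e a v ≡ 1ℤ
  difference-swap a b v eq = trans (swap (e a v) (e b v)) (cong ℤ.-_ eq)
    where
    swap : ∀ x y → y ℤ.- x ≡ ℤ.- (x ℤ.- y)
    swap = ℤ-Solver.solve-∀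

  -- Since a ≠ b nothing cancels on the right: its value 1 at a forces the source, and its value -1
  -- at b the target.
  arc-unique : ∀ {N} {u v : Fin N} {a b} → 1 ℕ.≤ a → a ℕ.< b → b ℕ.≤ N →
    e (pos u) ⊝ e (pos v) ≗ e {N} a ⊝ e b → pos u ≡ a × pos v ≡ b
  arc-unique {u = u} {v} {a} {b} 1≤a a<b b≤N eq =
    let s , pos-s = vertexAt a 1≤a (ℕₚ.≤-trans (ℕₚ.<⇒≤ a<b) b≤N)
        t , pos-t = vertexAt b (ℕₚ.≤-trans 1≤a (ℕₚ.<⇒≤ a<b)) b≤N
    in trans (difference-one (pos u) (pos v) s (trans (eq s)
         (cong₂ ℤ._-_ (e-same a s (sym pos-s))
           (e-other b s (λ b≡s → ℕₚ.<⇒≢ a<b (sym (trans b≡s pos-s))))))) pos-s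
     , trans (difference-one (pos v) (pos u) t (difference-swap (pos u) (pos v) t (trans (eq t)
         (cong₂ ℤ._-_ (e-other a t (λ a≡t → ℕₚ.<⇒≢ a<b (trans a≡t pos-t)))
           (e-same b t (sym pos-t)))))) pos-t

-- The graph of a matrix with interval columns

module IntervalGraph {n q : ℕ} (B : Matrix n q)
  (intervals : (j : Fin q) → Intervals.IsInterval (column B j)) where
  open Boundary
  open UnitVectors
  open Intervals
  open Arcs

  graph : ∃ λ (G : Multigraph (suc n) q) → G hasEdges∂ B
  graph = record { src = λ j → proj₁ (arc (intervals j)) ; tgt = λ j → proj₁ (proj₂ (arc (intervals j))) }
        , λ j → proj₂ (proj₂ (arc (intervals j)))

  module _ (G : Multigraph (suc n) q) (edges : G hasEdges∂ B) where
    open Multigraph G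
    open GraphicMatroid B G edges

    interval-runs : ∀ j a b → 1 ℕ.≤ a → a ℕ.≤ b → b ℕ.≤ n →
      column B j ≗ 𝟙[ a , b ] → j runs a ⟶ suc b
    interval-runs j a b 1≤a a≤b b≤n eq = arc-unique 1≤a (ℕ.s≤s a≤b) (ℕ.s≤s b≤n) λ i →
      trans (sym (edges j i)) (trans (∂-cong eq i) (∂-𝟙 a b 1≤a a≤b b≤n i))

    prefix-runs : ∀ j k → 1 ℕ.≤ k → k ℕ.< n → column B j ≗ 𝟙[ 1 , k ] → j runs α ⟶ suc k
    prefix-runs j k 1≤k k<n = interval-runs j 1 k ℕₚ.≤-refl 1≤k (ℕₚ.<⇒≤ k<n)

    suffix-runs : ∀ j k → 1 ℕ.≤ k → k ℕ.< n → column B j ≗ 𝟙[ suc k , n ] → j runs suc k ⟶ ω n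
    suffix-runs j k 1≤k k<n = interval-runs j (suc k) n (ℕ.s≤s ℕ.z≤n) k<n ℕₚ.≤-refl

    full-runs : ∀ j → IsFull (column B j) → j runs α ⟶ ω n
    full-runs j eq with n ℕₚ.≟ 0
    -- Without rows there is a single vertex, which is both `α` and `ω 0`.
    ... | yes refl = only (src j) , only (tgt j)
      where
      only : ∀ (v : Fin 1) → pos v ≡ 1
      only zero = refl
    ... | no n≢0 = interval-runs j 1 n ℕₚ.≤-refl (ℕₚ.n≢0⇒n>0 n≢0) ℕₚ.≤-refl eq

    loop⇒zero : ∀ {j} → IsLoop j → IsZero (column B j)
    loop⇒zero {j} loop k = trans (column-gradient k j)
      (trans (cong (λ v → partialSums (e (pos (src j))) k ℤ.- partialSums (e (pos v)) k) (sym loop))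
        (ℤₚ.+-inverseʳ (partialSums (e (pos (src j))) k)))

    zero⇒loop : ∀ {j} → IsZero (column B j) → IsLoop j
    zero⇒loop {j} x≡0 = decidable-stable (src j Finₚ.≟ tgt j) λ src≢tgt →
      contradiction
        (trans (sym (cong₂ ℤ._-_ (e-same (pos (src j)) (src j) refl)
                 (e-other (pos (tgt j)) (src j) (src≢tgt ∘ sym ∘ pos-injective))))
          (trans (sym (edges j (src j))) (∂-zero x≡0 (src j))))
        λ ()

    adjacent : ∀ j → ¬ IsLoop j → AdjacentInK n (src j) (tgt j)
    adjacent j not-loop with interval-trichotomy (intervals j) (not-loop ∘ zero⇒loop)
    ... | inj₁ (k , 1≤k , k<n , eq) =
          let from , to = prefix-runs j k 1≤k k<n eq
          in inj₁ (inj₁ from , subst (2 ℕ.≤_) (sym to) (ℕ.s≤s 1≤k) , subst (ℕ._≤ n) (sym to) k<n)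
    ... | inj₂ (inj₁ (k , 1≤k , k<n , eq)) =
          let from , to = suffix-runs j k 1≤k k<n eq
          in inj₂ (inj₁ ((subst (2 ℕ.≤_) (sym from) (ℕ.s≤s 1≤k) , subst (ℕ._≤ n) (sym from) k<n) , inj₂ to))
    ... | inj₂ (inj₂ eq) = inj₂ (inj₂ (inj₁ (full-runs j eq)))

-- Parity

module Parity where
  open import Data.Integer.Base using (+_; -_; _+_; _-_; _*_)

  Even : ℤ → Set
  Even x = + 2 ∣ x

  -- `Odd` merely denies divisibility; the witness given here reduces parity claims to ring
  -- identities.
  HalfOdd : ℤ → Set
  HalfOdd y = ∃ λ u → y ≡ + 2 * u + 1ℤ

  halfOdd⇒odd : ∀ {y} → HalfOdd y → Odd y
  halfOdd⇒odd {y} (u , y≡) 2∣y = contradiction (ℕ∣.∣⇒≤ {1} {2} (∣⇒∣ᵤ 2∣1)) λ { (ℕ.s≤s ()) }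
    where
    2∣1 : + 2 ∣ 1ℤ
    2∣1 = ∣m+n∣m⇒∣n (subst (+ 2 ∣_) y≡ 2∣y) (∣m⇒∣m*n {m = + 2} u (divides 1ℤ refl))

  odd⇒halfOdd : ∀ {k} → Odd k → HalfOdd k
  odd⇒halfOdd {k} odd with k %ℕ 2 | n%ℕd<d k 2 | a≡a%ℕn+[a/ℕn]*n k 2
  ... | 0           | _                   | eq = contradiction (divides (k /ℕ 2) (trans eq (ℤₚ.+-identityˡ _))) odd
  ... | 1           | _                   | eq = k /ℕ 2 , trans eq (commute (k /ℕ 2))
    where
    commute : ∀ q → 1ℤ + q * + 2 ≡ + 2 * q + 1ℤ
    commute = ℤ-Solver.solve-∀
  ... | suc (suc _) | ℕ.s≤s (ℕ.s≤s ()) | _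

  halfOdd-neg : ∀ {y} → HalfOdd y → HalfOdd (-1ℤ * y)
  halfOdd-neg (u , refl) = - u - 1ℤ , rearrange u
    where
    rearrange : ∀ u → -1ℤ * (+ 2 * u + 1ℤ) ≡ + 2 * (- u - 1ℤ) + 1ℤ
    rearrange = ℤ-Solver.solve-∀

-- Signs and folded classes

module Signs where
  open import Data.Integer.Base using (+_; -_; _+_; _-_; _*_)
  open Parity

  Sign : ℤ → Set
  Sign s = s ≡ 1ℤ ⊎ s ≡ -1ℤ

  sign-* : ∀ {σ τ} → Sign σ → Sign τ → Sign (σ * τ)
  sign-* (inj₁ refl) (inj₁ refl) = inj₁ refl
  sign-* (inj₁ refl) (inj₂ refl) = inj₂ refl
  sign-* (inj₂ refl) (inj₁ refl) = inj₂ refl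
  sign-* (inj₂ refl) (inj₂ refl) = inj₁ refl

  -- The shape of a frozen entry in a block: row sign, column sign 1, and the row's folding sign
  -- once more.
  sign-square : ∀ {σ} → Sign σ → σ * 1ℤ * σ ≡ 1ℤ
  sign-square (inj₁ refl) = refl
  sign-square (inj₂ refl) = refl

  halfOdd-sign : ∀ {ε v} → Sign ε → HalfOdd v → HalfOdd (ε * v)
  halfOdd-sign {v = v} (inj₁ refl) odd = subst HalfOdd (sym (ℤₚ.*-identityˡ v)) odd
  halfOdd-sign         (inj₂ refl) odd = halfOdd-neg odd

  -- If the test for a ≡ c fails, `foldedClass-correct` leaves only a ≡ -c, so the default -1 is
  -- right.
  foldingSign-spec : ∀ m' a → Sign (foldingSign m' a) ×
    + modulus m' ∣ a - foldingSign m' a * + foldedClass m' a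
  foldingSign-spec m' a = go (+ t ∣? (a - + c))
    where
    t = modulus m'
    c = foldedClass m' a
    go : (d : Dec (+ t ∣ a - + c)) → let s = if does d then 1ℤ else -1ℤ in
      Sign s × + t ∣ a - s * + c
    go (yes t∣) = inj₁ refl , subst (λ z → + t ∣ a - z) (sym (ℤₚ.*-identityˡ (+ c))) t∣
    go (no  t∤) = inj₂ refl , subst (λ z → + t ∣ a - z) (sym (ℤₚ.-1*i≡-i (+ c)))
      ([ (λ t∣ → contradiction t∣ t∤) , (λ t∣ → t∣) ]′ (proj₂ (foldedClass-correct m' a)))

  -- For c = 0 the residues c and -c coincide, so the test for the positive sign succeeds.
  foldingSign-zero : ∀ m' a → foldedClass m' a ≡ 0 → foldingSign m' a ≡ 1ℤ
  foldingSign-zero m' a c≡0 = cong (λ b → if b then 1ℤ else -1ℤ)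
    (dec-true (+ modulus m' ∣? (a - + foldedClass m' a))
      ([ (λ t∣ → t∣) , subst (λ c → + modulus m' ∣ a - - + c → + modulus m' ∣ a - + c) (sym c≡0) (λ t∣ → t∣)
       ]′ (proj₂ (foldedClass-correct m' a))))

-- Free entries as indicators of inequalities

module FreeEntries (m' : ℕ) where
  open import Data.Integer.Base using (+_; -_; _+_; _-_; _*_; _≤_; _<_)
  open Parity
  open Signs

  t : ℕ
  t = modulus m'

  t≡1+2m' : + t ≡ 1ℤ + + 2 * + m'
  t≡1+2m' = cong (_+_ 1ℤ) (ℤₚ.pos-* 2 m')

  -- As ε v, t and k are all odd, x = ε v - t k is a difference of two odd numbers.
  hit⇒even : ∀ ε v x → HalfOdd (ε * v) → FreeHit t ε v x → Even x
  hit⇒even ε v x (u , εv≡) (k , k-odd , _ , hit) =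
    let κ , k≡ = odd⇒halfOdd k-odd
    in divides (u - κ - + m' * (+ 2 * κ + 1ℤ)) (begin
         x                                        ≡⟨ isolate x (+ t * k) ⟩
         (x + + t * k) - + t * k                  ≡⟨ cong (_- + t * k) (trans (sym hit) εv≡) ⟩
         (+ 2 * u + 1ℤ) - + t * k                 ≡⟨ cong₂ (λ t k → (+ 2 * u + 1ℤ) - t * k) t≡1+2m' k≡ ⟩
         (+ 2 * u + 1ℤ) - (1ℤ + + 2 * + m') * (+ 2 * κ + 1ℤ) ≡⟨ rearrange u κ (+ m') ⟩
         (u - κ - + m' * (+ 2 * κ + 1ℤ)) * + 2    ∎)
    where
    open ≡-Reasoning
    isolate : ∀ x y → x ≡ (x + y) - y
    isolate = ℤ-Solver.solve-∀
    rearrange : ∀ u κ m → (+ 2 * u + 1ℤ) - (1ℤ + + 2 * m) * (+ 2 * κ + 1ℤ)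
                        ≡ (u - κ - m * (+ 2 * κ + 1ℤ)) * + 2
    rearrange = ℤ-Solver.solve-∀

  hit⇒< : ∀ ε v x → FreeHit t ε v x → x < ε * v
  hit⇒< ε v x (k , _ , 1≤k , hit) = subst (x <_) (sym hit)
    (subst (_< x + + t * k) (ℤₚ.+-identityʳ x) (ℤₚ.+-monoʳ-< x
      (subst (_< + t * k) (ℤₚ.*-zeroʳ (+ t)) (ℤₚ.*-monoˡ-<-pos (+ t) (ℤₚ.suc[i]≤j⇒i<j 1≤k)))))

  -- The required k is the quotient q. Were it even, ε v = x + q t would be even too; it is positive
  -- because ε v - x and t are.
  even∧<⇒hit : ∀ ε v x → HalfOdd (ε * v) → + t ∣ ε * v - x → Even x → x < ε * v → FreeHit t ε v x
  even∧<⇒hit ε v x εv-odd (divides q εv-x≡qt) even x<εv =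
    q , q-odd , ℤₚ.i<j⇒suc[i]≤j 0<q
      , trans (expand (ε * v) x) (cong (_+_ x) (trans εv-x≡qt (ℤₚ.*-comm q (+ t))))
    where
    expand : ∀ y x → y ≡ x + (y - x)
    expand = ℤ-Solver.solve-∀
    q-odd : Odd q
    q-odd 2∣q = halfOdd⇒odd εv-odd (subst (+ 2 ∣_) (sym (expand (ε * v) x))
      (∣m∣n⇒∣m+n even (subst (+ 2 ∣_) (sym εv-x≡qt) (∣m⇒∣m*n (+ t) 2∣q))))
    0<q : 0ℤ < q
    0<q = ℤₚ.*-cancelʳ-<-nonNeg (+ t) (subst (0ℤ <_) εv-x≡qt
      (subst (_< ε * v - x) (ℤₚ.+-inverseʳ x) (ℤₚ.+-monoˡ-< (- x) x<εv)))

  -- `freeEntry` with its two decisions as arguments, so that they can be matched on; `freeHit?`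
  -- supplies them later.
  contributions : ∀ v x → Dec (FreeHit t 1ℤ v x) → Dec (FreeHit t -1ℤ v x) → ℤ
  contributions v x d₊ d₋ = (if does d₊ then 1ℤ else 0ℤ) + (if does d₋ then -1ℤ else 0ℤ)

  one-sided : ∀ {ε} v x → Sign ε → ¬ FreeHit t (- ε) v x →
    (d₊ : Dec (FreeHit t 1ℤ v x)) (d₋ : Dec (FreeHit t -1ℤ v x)) →
    (FreeHit t ε v x × ε * contributions v x d₊ d₋ ≡ 1ℤ) ⊎ (¬ FreeHit t ε v x × ε * contributions v x d₊ d₋ ≡ 0ℤ)
  one-sided v x (inj₁ refl) miss _         (yes h₋) = contradiction h₋ miss
  one-sided v x (inj₁ refl) miss (yes h₊)  (no  _)  = inj₁ (h₊ , refl)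
  one-sided v x (inj₁ refl) miss (no  ¬h₊) (no  _)  = inj₂ (¬h₊ , refl)
  one-sided v x (inj₂ refl) miss (yes h₊)  _        = contradiction h₊ miss
  one-sided v x (inj₂ refl) miss (no  _)   (yes h₋) = inj₁ (h₋ , refl)
  one-sided v x (inj₂ refl) miss (no  _)   (no ¬h₋) = inj₂ (¬h₋ , refl)

  -- Modulo t, σ τ v ≡ σ² τ c = τ c ≡ x. Splitting on σ is what brings σ² = 1 within reach of the
  -- ring solver.
  aligned : ∀ {σ τ} v x c → Sign σ → Sign τ → + t ∣ v - σ * c → + t ∣ x - τ * c →
    + t ∣ (σ * τ) * v - x
  aligned {σ} {τ} v x c σ-sign τ-sign t∣v t∣x =
    subst (+ t ∣_) (sym (split σ-sign)) (∣m∣n⇒∣m-n (∣n⇒∣m*n (σ * τ) t∣v) t∣x)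
    where
    split₊ : ∀ τ v x c → (1ℤ * τ) * v - x ≡ (1ℤ * τ) * (v - 1ℤ * c) - (x - τ * c)
    split₊ = ℤ-Solver.solve-∀
    split₋ : ∀ τ v x c → (-1ℤ * τ) * v - x ≡ (-1ℤ * τ) * (v - -1ℤ * c) - (x - τ * c)
    split₋ = ℤ-Solver.solve-∀
    split : Sign σ → (σ * τ) * v - x ≡ (σ * τ) * (v - σ * c) - (x - τ * c)
    split (inj₁ refl) = split₊ τ v x c
    split (inj₂ refl) = split₋ τ v x c

  -- If both ± ε v were congruent to x, then t would divide 2x, hence 2c, which lies in {2,…,t-1}.
  misaligned : ∀ {ε τ} v x c → 1 ℕ.≤ c → c ℕ.≤ m' → Sign τ → + t ∣ x - τ * + c →
    + t ∣ ε * v - x → ¬ FreeHit t (- ε) v x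
  misaligned {ε} {τ} v x (suc c-1) _ c≤m' τ-sign t∣x t∣εv-x (k , _ , _ , hit) =
    contradiction (ℕ∣.∣⇒≤ (∣⇒∣ᵤ (t∣2c τ-sign t∣x))) (ℕₚ.<⇒≱ 2c<t)
    where
    c = suc c-1
    2c<t : c ℕ.+ c ℕ.< t
    2c<t = ℕ.s≤s (ℕₚ.+-mono-≤ c≤m' (ℕₚ.≤-trans c≤m' (ℕₚ.≤-reflexive (sym (ℕₚ.+-identityʳ m')))))
    double : ∀ ε v x → - ((- ε * v - x) + (ε * v - x)) ≡ x + x
    double = ℤ-Solver.solve-∀
    quotient : ∀ x tk → (x + tk) - x ≡ tk
    quotient = ℤ-Solver.solve-∀
    t∣-εv-x : + t ∣ - ε * v - x
    t∣-εv-x = divides k (trans (cong (_- x) hit) (trans (quotient x (+ t * k)) (ℤₚ.*-comm (+ t) k)))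
    t∣2x : + t ∣ x + x
    t∣2x = subst (+ t ∣_) (double ε v x) (∣m⇒∣-m (∣m∣n⇒∣m+n t∣-εv-x t∣εv-x))
    reduce₊ : ∀ x c → (x + x) - ((x - 1ℤ * c) + (x - 1ℤ * c)) ≡ c + c
    reduce₊ = ℤ-Solver.solve-∀
    reduce₋ : ∀ x c → ((x - -1ℤ * c) + (x - -1ℤ * c)) - (x + x) ≡ c + c
    reduce₋ = ℤ-Solver.solve-∀
    t∣2c : Sign τ → + t ∣ x - τ * + c → + t ∣ + c + + c
    t∣2c (inj₁ refl) t∣ = subst (+ t ∣_) (reduce₊ x (+ c)) (∣m∣n⇒∣m-n t∣2x (∣m∣n⇒∣m+n t∣ t∣))
    t∣2c (inj₂ refl) t∣ = subst (+ t ∣_) (reduce₋ x (+ c)) (∣m∣n⇒∣m-n (∣m∣n⇒∣m+n t∣ t∣) t∣2x)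

  regroup : ∀ σ τ v → (σ * τ) * v ≡ τ * (σ * v)
  regroup = ℤ-Solver.solve-∀

  -- Only ε = σ τ can hit, by `misaligned`. Writing ε v as τ (σ v) expresses the condition through σ
  -- v, by which the rows are sorted.
  positive-class-entry : ∀ {σ τ} v x c → 1 ℕ.≤ c → c ℕ.≤ m' → Sign σ → Sign τ →
    + t ∣ v - σ * + c → + t ∣ x - τ * + c → HalfOdd v →
    (d₊ : Dec (FreeHit t 1ℤ v x)) (d₋ : Dec (FreeHit t -1ℤ v x)) →
    let P = Even x × x < τ * (σ * v)
        entry = (σ * τ) * contributions v x d₊ d₋
    in (P × entry ≡ 1ℤ) ⊎ (¬ P × entry ≡ 0ℤ)
  positive-class-entry {σ} {τ} v x c 1≤c c≤m' σ-sign τ-sign t∣v t∣x v-odd d₊ d₋ =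
    [ (λ (hit , eq) → inj₁ ((hit⇒even ε v x εv-odd hit
                            , subst (x <_) (regroup σ τ v) (hit⇒< ε v x hit)) , eq))
    , (λ (miss , eq) → inj₂ ((λ (even , x<) →
        miss (even∧<⇒hit ε v x εv-odd t∣εv-x even (subst (x <_) (sym (regroup σ τ v)) x<))) , eq))
    ]′ (one-sided v x ε-sign (misaligned {ε} {τ} v x c 1≤c c≤m' τ-sign t∣x t∣εv-x) d₊ d₋)
    where
    ε = σ * τ
    ε-sign = sign-* σ-sign τ-sign
    εv-odd : HalfOdd (ε * v)
    εv-odd = halfOdd-sign ε-sign v-odd
    t∣εv-x : + t ∣ ε * v - x
    t∣εv-x = aligned v x (+ c) σ-sign τ-sign t∣v t∣x

  -- In class 0 both signs contribute: for x < 0 the entry is [v > x] - [v < -x] = [v > -x].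
  zero-class-entry : ∀ v x → 0ℤ < v → HalfOdd v → + t ∣ v → + t ∣ x →
    (d₊ : Dec (FreeHit t 1ℤ v x)) (d₋ : Dec (FreeHit t -1ℤ v x)) →
    let P = Even x × x < v × - x < v
        entry = 1ℤ * contributions v x d₊ d₋
    in (P × entry ≡ 1ℤ) ⊎ (¬ P × entry ≡ 0ℤ)
  zero-class-entry v x 0<v v-odd t∣v t∣x = entry
    where
    hit₊ : Even x → x < v → FreeHit t 1ℤ v x
    hit₊ even x<v = even∧<⇒hit 1ℤ v x (halfOdd-sign (inj₁ refl) v-odd)
      (∣m∣n⇒∣m-n (∣n⇒∣m*n 1ℤ t∣v) t∣x) even (subst (x <_) (sym (ℤₚ.*-identityˡ v)) x<v)
    hit₋ : Even x → x < - v → FreeHit t -1ℤ v x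
    hit₋ even x<-v = even∧<⇒hit -1ℤ v x (halfOdd-neg v-odd)
      (∣m∣n⇒∣m-n (∣n⇒∣m*n -1ℤ t∣v) t∣x) even (subst (x <_) (sym (ℤₚ.-1*i≡-i v)) x<-v)
    even₊ : FreeHit t 1ℤ v x → Even x
    even₊ = hit⇒even 1ℤ v x (halfOdd-sign (inj₁ refl) v-odd)
    <₊ : FreeHit t 1ℤ v x → x < v
    <₊ h = subst (x <_) (ℤₚ.*-identityˡ v) (hit⇒< 1ℤ v x h)
    even₋ : FreeHit t -1ℤ v x → Even x
    even₋ = hit⇒even -1ℤ v x (halfOdd-neg v-odd)
    <₋ : FreeHit t -1ℤ v x → x < - v
    <₋ h = subst (x <_) (ℤₚ.-1*i≡-i v) (hit⇒< -1ℤ v x h)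

    entry : (d₊ : Dec (FreeHit t 1ℤ v x)) (d₋ : Dec (FreeHit t -1ℤ v x)) →
      let P = Even x × x < v × - x < v
          value = 1ℤ * contributions v x d₊ d₋
      in (P × value ≡ 1ℤ) ⊎ (¬ P × value ≡ 0ℤ)
    entry (yes h₊)  (yes h₋) = inj₂ ((λ (_ , _ , -x<v) →
      ℤₚ.<-asym -x<v (subst (_< - x) (ℤₚ.neg-involutive v) (ℤₚ.neg-mono-< (<₋ h₋)))) , refl)
    -- No hit for -1 yields only -x ≤ v; equality is excluded because v is odd and x even.
    entry (yes h₊)  (no ¬h₋) = inj₁ ((even₊ h₊ , <₊ h₊ , ℤₚ.≤∧≢⇒< -x≤v -x≢v) , refl)
      where
      -x≤v : - x ≤ v
      -x≤v = subst (- x ≤_) (ℤₚ.neg-involutive v) (ℤₚ.neg-mono-≤ (ℤₚ.≮⇒≥ (¬h₋ ∘ hit₋ (even₊ h₊))))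
      -x≢v : - x ≢ v
      -x≢v eq = halfOdd⇒odd v-odd (subst Even eq (∣m⇒∣-m (even₊ h₊)))
    -- As v is positive, x < -v implies x < v, so a hit for -1 brings one for 1 with it.
    entry (no ¬h₊) (yes h₋) = contradiction
      (hit₊ (even₋ h₋) (ℤₚ.<-trans (<₋ h₋) (ℤₚ.<-trans (ℤₚ.neg-mono-< 0<v) 0<v))) ¬h₊
    entry (no ¬h₊) (no _)   = inj₂ ((λ (even , x<v , _) → ¬h₊ (hit₊ even x<v)) , refl)

-- The columns of a block are intervals

module Blocks (m' r : ℕ) (Λ : Fin (m' ℕ.+ r) → ℕ) (X : Fin r → ℤ) where
  open import Data.Integer.Base using (+_; -_; _+_; _-_; _*_; _≤_; _<_)
  open Parity
  open Signs
  open FreeEntries m'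
  open Intervals

  R' : ℕ
  R' = m' ℕ.+ r

  V-halfOdd : ∀ i → HalfOdd (V m' r Λ X i)
  V-halfOdd i = + Λ i + (+ R' - + pos i) , factor (+ Λ i) (+ R' - + pos i)
    where
    factor : ∀ a b → + 2 * a + + 2 * b + 1ℤ ≡ + 2 * (a + b) + 1ℤ
    factor = ℤ-Solver.solve-∀

  -- This breaks the symmetry between the two signs in class 0.
  V-positive : ∀ i → 0ℤ < V m' r Λ X i
  V-positive i = ℤₚ.+-mono-≤-< (ℤₚ.+-mono-≤
      (ℤₚ.*-monoˡ-≤-nonNeg (+ 2) {0ℤ} {+ Λ i} (ℤ.+≤+ ℕ.z≤n))
      (ℤₚ.*-monoˡ-≤-nonNeg (+ 2) {0ℤ} {+ R' - + pos i} (ℤₚ.i≤j⇒0≤j-i (ℤ.+≤+ (Finₚ.toℕ<n i)))))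
    (ℤ.+<+ (ℕ.s≤s ℕ.z≤n))

  lookup-filter : ∀ {A : Set} {P : A → Set} (P? : Decidable P) xs k → P (lookup (filter P? xs) k)
  lookup-filter P? xs k = All.lookup (all-filter P? xs) (∈-lookup k)

  module _ (c : ℕ) (c≤m' : c ℕ.≤ m') where
    row : Fin (height m' r Λ X c) → Fin R'
    row = lookup (blockRows m' r Λ X c)

    row-class : ∀ k → rowClass m' r Λ X (row k) ≡ c
    row-class = lookup-filter (λ i → rowClass m' r Λ X i ℕₚ.≟ c) (sortedRows m' r Λ X)

    -- Filtering keeps the rows sorted lexicographically by class and `w`; within one class the
    -- first components agree, which leaves the comparison of `w`.
    w-mono : ∀ k l → toℕ k ℕ.≤ toℕ l → w m' r Λ X (row k) ≤ w m' r Λ X (row l)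
    w-mono k l k≤l = [ (λ (_ , ≢) → contradiction (trans (row-class k) (sym (row-class l))) ≢) , proj₂ ]′
      (lookup-mono-≤ O (filter⁺ O (λ i → rowClass m' r Λ X i ℕₚ.≟ c)
        (Sort.sort-↗ (rowOrder m' r Λ X) (allFin R'))) k≤l)
      where
      O = DecTotalOrder.totalOrder (rowOrder m' r Λ X)

    v : Fin (height m' r Λ X c) → ℤ
    v k = V m' r Λ X (row k)

    σ : Fin (height m' r Λ X c) → ℤ
    σ k = rowSign m' r Λ X (row k)

    row-residue : ∀ k → + t ∣ v k - σ k * + c
    row-residue k = subst (λ c → + t ∣ v k - σ k * + c) (row-class k) (proj₂ (foldingSign-spec m' (v k)))

    frozen-entry : ∀ p → askedClass m' r Λ X p ≡ c → ∀ k →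
      σ k * 1ℤ * frozenEntry m' r Λ X (row k) p ≡ 1ℤ
    frozen-entry p asked k = trans
      (cong (λ b → σ k * 1ℤ * (if b then σ k else 0ℤ))
        (dec-true (foldedClass m' (v k) ℕₚ.≟ askedClass m' r Λ X p) (trans (row-class k) (sym asked))))
      (sign-square (proj₁ (foldingSign-spec m' (v k))))

    freeColumn : Fin r → Vector ℤ (height m' r Λ X c)
    freeColumn j k = σ k * foldingSign m' (X j) * freeEntry m' r Λ X (row k) j

    column-residue : ∀ j → foldedClass m' (X j) ≡ c → + t ∣ X j - foldingSign m' (X j) * + c
    column-residue j class-j =
      subst (λ c → + t ∣ X j - foldingSign m' (X j) * + c) class-j (proj₂ (foldingSign-spec m' (X j)))

    -- All folding signs are 1 here, so `w` is `V`, and the condition that v exceeds both x and -x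
    -- persists as v grows.
    zero-class-interval : ∀ j → foldedClass m' (X j) ≡ c → c ≡ 0 → IsInterval (freeColumn j)
    zero-class-interval j class-j c≡0 = inj₂ (upClosed⇒suffix P (freeColumn j) indicates
      (λ k l k≤l (even , x< , -x<) →
        even , ℤₚ.<-≤-trans x< (v-mono k l k≤l) , ℤₚ.<-≤-trans -x< (v-mono k l k≤l)))
      where
      x = X j
      P : Fin (height m' r Λ X c) → Set
      P k = Even x × x < v k × - x < v k
      σ≡1 : ∀ k → σ k ≡ 1ℤ
      σ≡1 k = foldingSign-zero m' (v k) (trans (row-class k) c≡0)
      τ≡1 : foldingSign m' x ≡ 1ℤ
      τ≡1 = foldingSign-zero m' x (trans class-j c≡0)
      w≡v : ∀ k → w m' r Λ X (row k) ≡ v k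
      w≡v k = trans (cong (_* v k) (σ≡1 k)) (ℤₚ.*-identityˡ (v k))
      v-mono : ∀ k l → toℕ k ℕ.≤ toℕ l → v k ≤ v l
      v-mono k l k≤l = subst₂ _≤_ (w≡v k) (w≡v l) (w-mono k l k≤l)
      divisible : ∀ s z → s ≡ 1ℤ → + t ∣ z - s * + c → + t ∣ z
      divisible s z s≡1 = subst (+ t ∣_)
        (trans (cong₂ (λ s c → z - s * + c) s≡1 c≡0) (ℤₚ.+-identityʳ z))
      indicates : Indicates P (freeColumn j)
      indicates k = subst (λ s → (P k × s * freeEntry m' r Λ X (row k) j ≡ 1ℤ) ⊎
                                 (¬ P k × s * freeEntry m' r Λ X (row k) j ≡ 0ℤ))
        (sym (cong₂ _*_ (σ≡1 k) τ≡1))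
        (zero-class-entry (v k) x (V-positive (row k)) (V-halfOdd (row k))
          (divisible (σ k) (v k) (σ≡1 k) (row-residue k))
          (divisible (foldingSign m' x) x τ≡1 (column-residue j class-j))
          (freeHit? t 1ℤ (v k) x) (freeHit? t -1ℤ (v k) x))

    -- For τ = 1 the ones are the rows with w > x, a suffix; for τ = -1 the inequality reads x < -w
    -- and gives a prefix. Odd x makes `P` empty.
    positive-class-interval : ∀ j → foldedClass m' (X j) ≡ c → 1 ℕ.≤ c → IsInterval (freeColumn j)
    positive-class-interval j class-j 1≤c = byDirection (proj₁ (foldingSign-spec m' x))
      where
      x = X j
      τ = foldingSign m' x
      P : Fin (height m' r Λ X c) → Set
      P k = Even x × x < τ * w m' r Λ X (row k)
      indicates : Indicates P (freeColumn j)
      indicates k = positive-class-entry (v k) x c 1≤c c≤m'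
        (proj₁ (foldingSign-spec m' (v k))) (proj₁ (foldingSign-spec m' x))
        (row-residue k) (column-residue j class-j)
        (V-halfOdd (row k)) (freeHit? t 1ℤ (v k) x) (freeHit? t -1ℤ (v k) x)
      byDirection : Sign τ → IsInterval (freeColumn j)
      byDirection (inj₁ τ≡1) = inj₂ (upClosed⇒suffix P (freeColumn j) indicates
        λ k l k≤l (even , x<) → even , ℤₚ.<-≤-trans x<
          (subst (λ s → s * w m' r Λ X (row k) ≤ s * w m' r Λ X (row l)) (sym τ≡1)
            (ℤₚ.*-monoˡ-≤-nonNeg 1ℤ (w-mono k l k≤l))))
      byDirection (inj₂ τ≡-1) = inj₁ (downClosed⇒prefix P (freeColumn j) indicates
        λ k l k≤l (even , x<) → even , ℤₚ.<-≤-trans x<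
          (subst (λ s → s * w m' r Λ X (row l) ≤ s * w m' r Λ X (row k)) (sym τ≡-1)
            (ℤₚ.*-monoˡ-≤-nonPos -1ℤ (w-mono k l k≤l))))

    free-interval : ∀ j → foldedClass m' (X j) ≡ c → IsInterval (freeColumn j)
    free-interval j class-j = [ positive-class-interval j class-j
                              , zero-class-interval j class-j ∘ sym
                              ]′ (ℕₚ.m≤n⇒m<n∨m≡n ℕ.z≤n)

    -- Class, sign and entry of a column all branch on the same `splitAt`; with its value abstracted
    -- as `s`, one case split reduces all three.
    split-interval : ∀ s → [ askedClass m' r Λ X , (λ j → foldedClass m' (X j)) ]′ s ≡ c →
      IsInterval (λ k → σ k * [ (λ _ → 1ℤ) , (λ j → foldingSign m' (X j)) ]′ s
                      * [ frozenEntry m' r Λ X (row k) , freeEntry m' r Λ X (row k) ]′ s)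
    split-interval (inj₁ p) asked = inj₂ (0 , ℕ.z≤n , λ k → trans (frozen-entry p asked k) (𝟙-full k))
    split-interval (inj₂ j) class-j = free-interval j class-j

    block-interval : ∀ l → IsInterval (column (block m' r Λ X c) l)
    block-interval l = split-interval (splitAt m' (lookup (blockColumns m' r Λ X c) l))
      (lookup-filter (λ j → columnClass m' r Λ X j ℕₚ.≟ c) (allFin R') l)

open import Data.Nat.Base using (_+_; _≤_; _<_)

proposition5p29 :
  (m' r : ℕ) → 3 ≤ modulus m' → 2 ≤ r →
  (Λ : Fin (m' + r) → ℕ) → (∀ i j → toℕ i ≤ toℕ j → Λ j ≤ Λ i) →
  (X : Fin r → ℤ) →
  (c : ℕ) → c ≤ m' →
  let n = height m' r Λ X c
      q = width m' r Λ X c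
      B = block m' r Λ X c
  in
    Injective _≗_ _≗_ (∂ {n}) ×
    (∀ (x y : Vector ℤ n) → ∂ (x ⊕ y) ≗ ∂ x ⊕ ∂ y) ×
    (∀ (x : Vector ℤ n) → RootLattice n (∂ x)) ×
    (∀ (x : Vector ℤ n) → partialSums (∂ x) ≗ x) ×
    (∀ (y : Vector ℤ (suc n)) → RootLattice n y → ∂ (partialSums y) ≗ y) ×
    (∀ a b → 1 ≤ a → a ≤ b → b ≤ n → ∂ {n} 𝟙[ a , b ] ≗ e a ⊝ e (suc b)) ×
    (∀ j → ¬ IsZero (column B j) →
      IsProperPrefix (column B j) ⊎ IsProperSuffix (column B j) ⊎ IsFull (column B j)) ×
    -- the graph G_B exists, and every choice of it (i.e. of base points of its loops) satisfies
    ∃ (λ (G : Multigraph (suc n) q) → G hasEdges∂ B) ×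
    ((G : Multigraph (suc n) q) → G hasEdges∂ B →
      let open Multigraph G in
      (∀ j k → 1 ≤ k → k < n → column B j ≗ 𝟙[ 1 , k ] → j runs α ⟶ suc k) ×
      (∀ j k → 1 ≤ k → k < n → column B j ≗ 𝟙[ suc k , n ] → j runs suc k ⟶ ω n) ×
      (∀ j → IsFull (column B j) → j runs α ⟶ ω n) ×
      (∀ j → IsLoop j ⇔ IsZero (column B j)) ×
      (∀ j → ¬ IsLoop j → AdjacentInK n (src j) (tgt j)) ×
      (∀ (S : Subset q) → columnMatroid B S ⇔ cycleMatroid G S) ×
      (LinearlyIndependentColumns B ⇔ Forest G))
proposition5p29 m' r _ _ Λ _ X c c≤m' =
  ∂-injective , ∂-⊕ , sum-∂ , partialSums-∂ , ∂-partialSums , ∂-𝟙 ,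
  (λ j → interval-trichotomy (intervals j)) , graph , λ G edges →
    prefix-runs G edges , suffix-runs G edges , full-runs G edges ,
    (λ j → mk⇔ (loop⇒zero G edges) (zero⇒loop G edges)) , adjacent G edges ,
    GraphicMatroid.columnMatroid⇔cycleMatroid B G edges ,
    GraphicMatroid.independent⇔forest B G edges
  where
  open Boundary
  open Intervals
  B = block m' r Λ X c
  intervals = Blocks.block-interval m' r Λ X c c≤m'
  open IntervalGraph B intervals
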